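{- For every integer $\gamma\ge 2$, there exists an algorithm for the minimum spanning tree problem under explorable uncertainty with predictions that is $\min\left\{1+\frac{1}{\gamma}+\frac{5\,k_h}{|\mathrm{OPT}|},\ \gamma+1\right\}$-competitive, i.e., on every instance it queries a set $\mathrm{ALG}$ with $|\mathrm{ALG}|\le \min\left\{1+\frac{1}{\gamma}+\frac{5\,k_h}{|\mathrm{OPT}|},\ \gamma+1\right\}\cdot|\mathrm{OPT}|$.
   Context: MST problem under explorable uncertainty with predictions: an instance is a connected (multi)graph $G=(V,E)$. Each edge $e$ has an unknown true weight $w_e\in\mathbb{R}_+$ and a known uncertainty interval $I_e$, either an open interval $(L_e,U_e)$ containing $w_e$ or the trivial interval $\{w_e\}$ (then $L_e=U_e=w_e$). Querying an edge reveals $w_e$. A set $Q\subseteq E$ is a feasible query set if there is a spanning tree $T$ that is a minimum spanning tree for every weight assignment that equals $w_e$ for $e\in Q$ and takes arbitrary values in $I_e$ for $e\notin Q$. $\mathrm{OPT}$ is a feasible query set of minimum cardinality. An algorithm queries edges adaptively until its set $\mathrm{ALG}$ of queried edges is feasible; it is given a prediction $\hat w_e\in I_e$ for every edge. Hop distance: for distinct edges $e,e'$, let $k_{e'}(e)=0$ if $w_e$ and $\hat w_e$ lie in the same one of the three regions $(-\infty,L_{e'}]$, $(L_{e'},U_{e'})$, $[U_{e'},\infty)$, and $k_{e'}(e)=1$ otherwise. The hop distance is $k_h=\sum_{e\in E}\sum_{e'\in E\setminus\{e\}}k_{e'}(e)$.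
   Formalization: The edge weights, the endpoints of the uncertainty intervals, the predictions and the weight assignments in the definition of a feasible query set are rational numbers instead of real numbers. -}

module Defs where

open import Data.Nat as ℕ using (ℕ; zero; suc)
open import Data.Rational as ℚ using (ℚ; 0ℚ; _≤ᵇ_)
open import Data.Bool using (Bool; true; false; if_then_else_; _∧_; _∨_; not)
open import Data.Fin using (Fin; zero; suc; _≟_)
open import Data.Fin.Subset using (Subset; _∈_; _∉_; ⊥; ⊤; _∪_; ⁅_⁆; ∣_∣)
open import Data.Vec using ([]; _∷_)
open import Data.List using (List; []; _∷_; foldr)
open import Data.List.Relation.Unary.Unique.Propositional using (Unique)
open import Data.Product using (Σ; ∃; _×_; _,_; proj₁; proj₂)
open import Data.Maybe using (Maybe; just; nothing)
open import Relation.Binary.PropositionalEquality using (_≡_)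
open import Relation.Nullary using (¬_; yes; no)
open import Function using (_∘_)
open import Data.Unit using () renaming (⊤ to ⊤′)

-- Multigraphs: vertices Fin n, edges Fin m, each edge has two endpoints
-- (parallel edges and loops allowed).

Ends : ℕ → ℕ → Set
Ends n m = Fin m → Fin n × Fin n

data Walk {n m : ℕ} (ends : Ends n m) (T : Subset m) :
          Fin n → Fin n → List (Fin m) → Set where
  stop : ∀ {v} → Walk ends T v v []
  fwd  : ∀ {u v es} (e : Fin m) → e ∈ T → proj₁ (ends e) ≡ u →
         Walk ends T (proj₂ (ends e)) v es → Walk ends T u v (e ∷ es)
  bwd  : ∀ {u v es} (e : Fin m) → e ∈ T → proj₂ (ends e) ≡ u →
         Walk ends T (proj₁ (ends e)) v es → Walk ends T u v (e ∷ es)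

Connected : ∀ {n m} → Ends n m → Subset m → Set
Connected {n} {m} ends T = (u v : Fin n) → ∃ λ es → Walk ends T u v es

Acyclic : ∀ {n m} → Ends n m → Subset m → Set
Acyclic {n} {m} ends T =
  (v : Fin n) (e : Fin m) (es : List (Fin m)) →
  ¬ (Walk ends T v v (e ∷ es) × Unique (e ∷ es))

SpanningTree : ∀ {n m} → Ends n m → Subset m → Set
SpanningTree ends T = Connected ends T × Acyclic ends T

wsum : ∀ {m} → Subset m → (Fin m → ℚ) → ℚ
wsum []           w = 0ℚ
wsum (b ∷ s) w = (if b then w zero else 0ℚ) ℚ.+ wsum s (w ∘ suc)

IsMST : ∀ {n m} → Ends n m → (Fin m → ℚ) → Subset m → Set
IsMST ends w T =
  SpanningTree ends T × (∀ T' → SpanningTree ends T' → wsum T w ℚ.≤ wsum T' w)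

data Interval : Set where
  opn : ℚ → ℚ → Interval
  pt  : ℚ → Interval

ValidInterval : Interval → Set
ValidInterval (opn L U) = L ℚ.< U
ValidInterval (pt a)    = ⊤′

_∈I_ : ℚ → Interval → Set
x ∈I opn L U = L ℚ.< x × x ℚ.< U
x ∈I pt a    = x ≡ a

lower upper : Interval → ℚ
lower (opn L U) = L
lower (pt a)    = a
upper (opn L U) = U
upper (pt a)    = a

record Instance (n m : ℕ) : Set where
  field
    ends      : Ends n m
    I         : Fin m → Interval
    pred      : Fin m → ℚ
    w         : Fin m → ℚ
    I-valid   : ∀ e → ValidInterval (I e)
    w∈I       : ∀ e → w e ∈I I e
    pred∈I    : ∀ e → pred e ∈I I e
    w-nonneg  : ∀ e → 0ℚ ℚ.≤ w e
    connected : Connected ends ⊤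
open Instance public

record Public (n m : ℕ) : Set where
  field
    ends : Ends n m
    I    : Fin m → Interval
    pred : Fin m → ℚ

public-info : ∀ {n m} → Instance n m → Public n m
public-info inst = record { ends = ends inst ; I = I inst ; pred = pred inst }

-- An adaptive query algorithm: from the public information and the history
-- of (queried edge, revealed weight) pairs, either query a next edge
-- (just e) or stop (nothing).
Strategy : Set
Strategy = ∀ {n m} → Public n m → List (Fin m × ℚ) → Maybe (Fin m)

run : ∀ {n m} → Strategy → Instance n m → ℕ → List (Fin m × ℚ) →
      Maybe (List (Fin m × ℚ))
run A inst zero    h = nothing
run A inst (suc k) h with A (public-info inst) h
... | nothing = just h
... | just e  = run A inst k ((e , w inst e) ∷ h)

queried : ∀ {m} → List (Fin m × ℚ) → Subset m
queried = foldr (λ p s → ⁅ proj₁ p ⁆ ∪ s) ⊥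

Feasible : ∀ {n m} → Instance n m → Subset m → Set
Feasible {n} {m} inst Q =
  ∃ λ (T : Subset m) → SpanningTree (ends inst) T ×
    ((w' : Fin m → ℚ) →
     (∀ e → e ∈ Q → w' e ≡ w inst e) →
     (∀ e → e ∉ Q → w' e ∈I I inst e) →
     IsMST (ends inst) w' T)

IsOPT : ∀ {n m} → Instance n m → Subset m → Set
IsOPT inst O = Feasible inst O × (∀ Q → Feasible inst Q → ∣ O ∣ ℕ.≤ ∣ Q ∣)

infix 4 _<ᵇ_
_<ᵇ_ : ℚ → ℚ → Bool
x <ᵇ y = not (y ≤ᵇ x)

sameRegion : Interval → ℚ → ℚ → Bool
sameRegion J x y =
  ((x ≤ᵇ L) ∧ (y ≤ᵇ L)) ∨ (((L <ᵇ x) ∧ (x <ᵇ U)) ∧ ((L <ᵇ y) ∧ (y <ᵇ U))) ∨ ((U ≤ᵇ x) ∧ (U ≤ᵇ y))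
  where L = lower J
        U = upper J

finSum : ∀ {m} → (Fin m → ℕ) → ℕ
finSum {zero}  f = 0
finSum {suc m} f = f zero ℕ.+ finSum (f ∘ suc)

hop : ∀ {n m} → Instance n m → Fin m → Fin m → ℕ
hop inst e e' with e ≟ e'
... | yes _ = 0
... | no  _ = if sameRegion (I inst e') (w inst e) (pred inst e) then 0 else 1

hopDistance : ∀ {n m} → Instance n m → ℕ
hopDistance inst = finSum (λ e → finSum (λ e' → hop inst e e'))

{-# OPTIONS --safe #-}
-- A query set is feasible iff every unqueried edge e with an open interval is either spanned by
-- edges that are certainly not heavier (Out) or not spanned by the edges that may be lighter (In).
-- This depends on the queried weights only through their region with respect to the interval
-- of e. Hence a set that is feasible for the predictions becomes feasible for the true weights
-- after adding the edges with respect to which a weight leaves its predicted region, and conversely;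
-- there are at most k_h such edges. The algorithm aims at the target set consisting of an optimal
-- query set for the predictions and all edges of this kind seen so far, so that the target has
-- at most |OPT| + 2 k_h elements. As long as the instance is unsolved, there are two unqueried edges
-- such that every feasible set contains one of them, and so does the target. In each group of
-- γ + 1 queries, the first γ are such target edges, and the last one is the partner of its
-- predecessor. So each group contains an edge of OPT, and at most one edge outside the target.
module Submission where

open import Defs
open import Data.Bool as Bool using (true; false; if_then_else_)
open import Data.Bool.Properties using (T-∨; T-∧)
open import Data.Fin using (Fin; zero; suc; _≟_; toℕ)
open import Data.Fin.Induction using (spo-wellFounded)
open import Data.Fin.Properties using (any?; all?; toℕ-injective; toℕ<n)
open import Data.Fin.Subset as S
  using (Subset; _∈_; _∉_; ⊤; _∪_; _∩_; _-_; _─_; ⁅_⁆; ∣_∣; inside; outside)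
open import Data.Fin.Subset.Properties
open import Data.List using (List; []; _∷_; length; allFin)
import Data.List.Membership.Propositional as L
open import Data.List.Membership.Propositional.Properties using (∈-allFin)
open import Data.List.Relation.Unary.All as All using (All; []; _∷_)
open import Data.List.Relation.Unary.All.Properties using (¬All⇒Any¬)
open import Data.List.Relation.Unary.AllPairs using ([]; _∷_)
open import Data.List.Relation.Unary.Any as Any using (Any; here; there)
open import Data.List.Relation.Unary.Unique.Propositional using (Unique)
open import Data.Maybe using (Maybe; just; nothing)
open import Data.Nat as ℕ using (ℕ; zero; suc; _+_; _*_; _≤_; s≤s; z≤n)
open import Data.Nat.Induction using (<-wellFounded)
import Data.Nat.Properties as ℕ
open import Data.Nat.Solver using (module +-*-Solver)
open import Data.Product using (Σ; ∃; ∃₂; _×_; _,_; proj₁; proj₂)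
open import Data.Rational as ℚ using (ℚ; 0ℚ; _≤ᵇ_; _⊔_; _⊓_)
import Data.Rational.Properties as ℚ
open import Data.Sum as Sum using (_⊎_; inj₁; inj₂; [_,_])
open import Data.Vec using ([]; _∷_; here; there; tabulate)
open import Data.Vec.Properties using (lookup⇒[]=; []=⇒lookup; lookup∘tabulate)
open import Function using (_∘_; id)
open import Function.Bundles using (module Equivalence)
open import Induction.WellFounded as WF using ()
open import Level using (0ℓ)
open import Relation.Binary using (IsStrictTotalOrder; Tri; tri<; tri≈; tri>)
import Relation.Binary.Construct.Flip.EqAndOrd as Flip
open import Relation.Binary.PropositionalEquality hiding ([_])
open import Relation.Nullary using (¬_; Dec; yes; no; does; contradiction; ¬?; _×-dec_; _⊎-dec_)
open import Relation.Nullary.Decidable as Dec using (decidable-stable; dec-true)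
open import Relation.Unary using (Pred; Decidable; _⊆_)

-- Spanning in graphs

module _ {m : ℕ} where

  EdgeSet : Set₁
  EdgeSet = Pred (Fin m) 0ℓ

  infixl 6 _⊕_ _⊝_

  _⊕_ _⊝_ : EdgeSet → Fin m → EdgeSet
  (A ⊕ e) g = A g ⊎ g ≡ e
  (A ⊝ e) g = A g × g ≢ e

  ⊕? : ∀ {A} → Decidable A → ∀ e → Decidable (A ⊕ e)
  ⊕? A? e g = A? g ⊎-dec (g ≟ e)

  ⊝? : ∀ {A} → Decidable A → ∀ e → Decidable (A ⊝ e)
  ⊝? A? e g = A? g ×-dec ¬? (g ≟ e)

  module _ {_≺_ : Fin m → Fin m → Set} (sto : IsStrictTotalOrder _≡_ _≺_) where
    open IsStrictTotalOrder sto

    minimum : ∀ {P : EdgeSet} → Decidable P → ∀ {x} → P x →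
              ∃ λ y → P y × (∀ {z} → P z → ¬ z ≺ y)
    minimum {P} P? {x} = go x
      where
      go : ∀ x → P x → ∃ λ y → P y × (∀ {z} → P z → ¬ z ≺ y)
      go = WF.All.wfRec (spo-wellFounded isStrictPartialOrder) 0ℓ _ step
        where
        step : ∀ x → (∀ {y} → y ≺ x → P y → ∃ λ y → P y × (∀ {z} → P z → ¬ z ≺ y)) →
               P x → ∃ λ y → P y × (∀ {z} → P z → ¬ z ≺ y)
        step x rec Px with any? (λ y → P? y ×-dec (y <? x))
        ... | yes (y , Py , y≺x) = rec y≺x Py
        ... | no none = x , Px , λ Pz z≺x → none (_ , Pz , z≺x)

  maximum : ∀ {_≺_ : Fin m → Fin m → Set} → IsStrictTotalOrder _≡_ _≺_ →
            ∀ {P : EdgeSet} → Decidable P → ∀ {x} → P x →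
            ∃ λ y → P y × (∀ {z} → P z → z ≢ y → z ≺ y)
  maximum {_≺_} sto P? Px with minimum (Flip.isStrictTotalOrder sto) P? Px
  ... | y , Py , max = y , Py , λ {z} Pz z≢y → below z Pz z≢y
    where
    below : ∀ z → _ → z ≢ y → z ≺ y
    below z Pz z≢y with IsStrictTotalOrder.compare sto z y
    ... | tri< z≺y _ _ = z≺y
    ... | tri≈ _ z≡y _ = contradiction z≡y z≢y
    ... | tri> _ _ y≺z = contradiction y≺z (max Pz)

module Graph {n m : ℕ} (ends : Ends n m) where

  src tgt : Fin m → Fin n
  src e = proj₁ (ends e)
  tgt e = proj₂ (ends e)

  -- Unlike `Walk`, this takes its edges from a predicate and keeps no edge list, so that steps can
  -- be replaced with whole paths.
  data Conn (A : EdgeSet) : Fin n → Fin n → Set where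
    ε    : ∀ {u} → Conn A u u
    fwd′ : ∀ {u v} e → A e → src e ≡ u → Conn A (tgt e) v → Conn A u v
    bwd′ : ∀ {u v} e → A e → tgt e ≡ u → Conn A (src e) v → Conn A u v

  -- The closure operator of the graphic matroid; a loop lies in the closure of the empty set.
  Span : EdgeSet → EdgeSet
  Span A e = Conn A (src e) (tgt e)

  infixr 5 _◅◅_
  _◅◅_ : ∀ {A u v x} → Conn A u v → Conn A v x → Conn A u x
  ε ◅◅ q = q
  fwd′ e Ae p r ◅◅ q = fwd′ e Ae p (r ◅◅ q)
  bwd′ e Ae p r ◅◅ q = bwd′ e Ae p (r ◅◅ q)

  edge : ∀ {A : EdgeSet} {e} → A e → Span A e
  edge {e = e} Ae = fwd′ e Ae refl ε

  reverse : ∀ {A u v} → Conn A u v → Conn A v u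
  reverse ε = ε
  reverse (fwd′ e Ae refl r) = reverse r ◅◅ bwd′ e Ae refl ε
  reverse (bwd′ e Ae refl r) = reverse r ◅◅ edge Ae

  conn-bind : ∀ {A B u v} → A ⊆ Span B → Conn A u v → Conn B u v
  conn-bind f ε = ε
  conn-bind f (fwd′ e Ae refl r) = f Ae ◅◅ conn-bind f r
  conn-bind f (bwd′ e Ae refl r) = reverse (f Ae) ◅◅ conn-bind f r

  bind : ∀ {A B} → A ⊆ Span B → Span A ⊆ Span B
  bind f = conn-bind f

  conn-mono : ∀ {A B u v} → A ⊆ B → Conn A u v → Conn B u v
  conn-mono f = conn-bind (edge ∘ f)

  mono : ∀ {A B} → A ⊆ B → Span A ⊆ Span B
  mono f = conn-mono f

  -- A walk can be shortened until it uses `e` at most once, in one of the two directions: if the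
  -- rest already passes through `e`, the detour between the two uses is dropped.
  conn-split : ∀ {A e u v} → Conn (A ⊕ e) u v →
    Conn A u v ⊎ Conn A u (src e) × Conn A (tgt e) v ⊎ Conn A u (tgt e) × Conn A (src e) v
  conn-split ε = inj₁ ε
  conn-split (fwd′ g (inj₁ Ag) refl r) with conn-split r
  ... | inj₁ p = inj₁ (edge Ag ◅◅ p)
  ... | inj₂ (inj₁ (p , q)) = inj₂ (inj₁ (edge Ag ◅◅ p , q))
  ... | inj₂ (inj₂ (p , q)) = inj₂ (inj₂ (edge Ag ◅◅ p , q))
  conn-split (fwd′ g (inj₂ refl) refl r) with conn-split r
  ... | inj₁ p = inj₂ (inj₁ (ε , p))
  ... | inj₂ (inj₁ (p , q)) = inj₂ (inj₁ (ε , q))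
  ... | inj₂ (inj₂ (p , q)) = inj₁ q
  conn-split (bwd′ g (inj₁ Ag) refl r) with conn-split r
  ... | inj₁ p = inj₁ (reverse (edge Ag) ◅◅ p)
  ... | inj₂ (inj₁ (p , q)) = inj₂ (inj₁ (reverse (edge Ag) ◅◅ p , q))
  ... | inj₂ (inj₂ (p , q)) = inj₂ (inj₂ (reverse (edge Ag) ◅◅ p , q))
  conn-split (bwd′ g (inj₂ refl) refl r) with conn-split r
  ... | inj₁ p = inj₂ (inj₂ (ε , p))
  ... | inj₂ (inj₁ (p , q)) = inj₁ q
  ... | inj₂ (inj₂ (p , q)) = inj₂ (inj₂ (ε , q))

  -- The exchange property of the matroid: a path for `e` that needs `g` forms a cycle with `e`, and
  -- the rest of this cycle joins the ends of `g`.
  exchange : ∀ {A e g} → Span (A ⊕ g) e → Span A e ⊎ Span (A ⊕ e) g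
  exchange {A} {e} {g} c with conn-split c
  ... | inj₁ p = inj₁ p
  ... | inj₂ (inj₁ (p , q)) =
    inj₂ (reverse (conn-mono inj₁ p) ◅◅ edge (inj₂ refl) ◅◅ reverse (conn-mono inj₁ q))
  ... | inj₂ (inj₂ (p , q)) =
    inj₂ (conn-mono inj₁ q ◅◅ reverse (edge (inj₂ refl)) ◅◅ conn-mono inj₁ p)

  exchange′ : ∀ {A e g} → A g → Span A e → ¬ Span (A ⊝ g) e → Span (A ⊝ g ⊕ e) g
  exchange′ {A} {e} {g} Ag s ¬s with exchange {A ⊝ g} {e} {g} (mono refine s)
    where
    refine : A ⊆ A ⊝ g ⊕ g
    refine {h} Ah with h ≟ g
    ... | yes p = inj₂ p
    ... | no  p = inj₁ (Ah , p)
  ... | inj₁ s′ = contradiction s′ ¬s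
  ... | inj₂ t  = t

  conn? : ∀ {A} → Decidable A → ∀ u v → Dec (Conn A u v)
  conn? {A} A? u v = Dec.map′ (conn-mono proj₁) (conn-mono (λ {g} Ag → Ag , ∈-allFin g)) (go (allFin m) u v)
    where
    _↾_ : EdgeSet → List (Fin m) → EdgeSet
    (A ↾ l) g = A g × g L.∈ l
    go : ∀ l u v → Dec (Conn (A ↾ l) u v)
    go [] u v with u ≟ v
    ... | yes refl = yes ε
    ... | no u≢v = no λ { ε → u≢v refl ; (fwd′ _ (_ , ()) _ _) ; (bwd′ _ (_ , ()) _ _) }
    go (g ∷ l) u v with A? g
    ... | no ¬Ag = Dec.map′ (conn-mono λ (Ah , h∈l) → Ah , there h∈l)
                            (conn-mono λ { (Ah , here refl) → contradiction Ah ¬Ag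
                                         ; (Ah , there h∈l) → Ah , h∈l }) (go l u v)
    ... | yes Ag = Dec.map′ join (conn-split ∘ conn-mono λ { (Ah , here h≡g) → inj₂ h≡g
                                                          ; (Ah , there h∈l) → inj₁ (Ah , h∈l) })
                     (go l u v ⊎-dec (go l u (src g) ×-dec go l (tgt g) v)
                               ⊎-dec (go l u (tgt g) ×-dec go l (src g) v))
      where
      weaken : ∀ {x y} → Conn (A ↾ l) x y → Conn (A ↾ (g ∷ l)) x y
      weaken = conn-mono λ (Ah , h∈l) → Ah , there h∈l
      new : Span (A ↾ (g ∷ l)) g
      new = edge (Ag , here refl)
      join : ∀ {x y} → Conn (A ↾ l) x y ⊎ Conn (A ↾ l) x (src g) × Conn (A ↾ l) (tgt g) y
             ⊎ Conn (A ↾ l) x (tgt g) × Conn (A ↾ l) (src g) y → Conn (A ↾ (g ∷ l)) x y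
      join (inj₁ p) = weaken p
      join (inj₂ (inj₁ (p , q))) = weaken p ◅◅ new ◅◅ weaken q
      join (inj₂ (inj₂ (p , q))) = weaken p ◅◅ reverse new ◅◅ weaken q

  span? : ∀ {A} → Decidable A → Decidable (Span A)
  span? A? e = conn? A? _ _

  record Circuit (A : EdgeSet) (e : Fin m) : Set₁ where
    field
      C       : EdgeSet
      C?      : Decidable C
      C⊆A     : C ⊆ A
      spans   : Span C e
      minimal : ∀ {g} → C g → ¬ Span (C ⊝ g) e

    rotate : ∀ {g} → C g → Span (C ⊝ g ⊕ e) g
    rotate Cg = exchange′ Cg spans (minimal Cg)

  -- One pass that drops every dispensable edge suffices, since an edge that is needed remains
  -- needed after further removals.
  circuit : ∀ {A} → Decidable A → ∀ {e} → Span A e → Circuit A e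
  circuit {A} A? {e} s = let C , C? , C⊆A , t , min = prune (allFin m) in record
    { C = C ; C? = C? ; C⊆A = C⊆A ; spans = t ; minimal = λ {g} → min (∈-allFin g) }
    where
    prune : ∀ l → Σ EdgeSet λ C → Decidable C × C ⊆ A × Span C e ×
            (∀ {g} → g L.∈ l → C g → ¬ Span (C ⊝ g) e)
    prune [] = A , A? , id , s , λ ()
    prune (g ∷ l) with prune l
    ... | C , C? , C⊆A , t , min with span? (⊝? C? g) e
    ... | yes t′ = C ⊝ g , ⊝? C? g , C⊆A ∘ proj₁ , t′ , λ
      { (here refl) (_ , g≢g) _ → g≢g refl
      ; (there h∈l) (Ch , _) r → min h∈l Ch (mono (λ { ((Ck , _) , k≢h) → Ck , k≢h }) r) }
    ... | no ¬t′ = C , C? , C⊆A , t , λ { (here refl) _ → ¬t′ ; (there h∈l) → min h∈l }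

  -- Only those edges of `A` are kept that may be exchanged for `e`. This extra property is what
  -- later yields bounds on their intervals.
  span-circuit : ∀ {A} → Decidable A → ∀ {e} → Span A e →
                 Span (λ g → A g × Span (A ⊝ g ⊕ e) g) e
  span-circuit A? s = mono (λ Cg → C⊆A Cg , mono weaken (rotate Cg)) spans
    where
    open Circuit (circuit A? s)
    weaken : ∀ {g} → C ⊝ g ⊕ _ ⊆ _ ⊝ g ⊕ _
    weaken (inj₁ (Ch , h≢g)) = inj₁ (C⊆A Ch , h≢g)
    weaken (inj₂ h≡e) = inj₂ h≡e

  -- If `B` spanned every edge of `A`, it would span whatever `A` spans.
  unspanned-edge : ∀ {A B e} → Decidable A → Decidable B → Span A e → ¬ Span B e →
                   ∃ λ g → A g × ¬ Span B g
  unspanned-edge A? B? s ¬s with any? (λ g → A? g ×-dec ¬? (span? B? g))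
  ... | yes found = found
  ... | no none = contradiction
    (bind (λ {g} Ag → decidable-stable (span? B? g) (λ ¬t → none (g , Ag , ¬t))) s) ¬s

  -- Kruskal's greedy tree

  module _ {_≺_ : Fin m → Fin m → Set} (sto : IsStrictTotalOrder _≡_ _≺_) where
    open IsStrictTotalOrder sto using (_<?_) renaming (isStrictPartialOrder to spo)

    Kruskal : EdgeSet
    Kruskal e = ¬ Span (_≺ e) e

    kruskal? : Decidable Kruskal
    kruskal? e = ¬? (span? (_<? e) e)

    -- A rejected edge is spanned by smaller edges, which by induction are spanned by accepted ones.
    kruskal-spans : ∀ e → Span (λ g → Kruskal g × (g ≺ e ⊎ g ≡ e)) e
    kruskal-spans = WF.All.wfRec (spo-wellFounded spo) 0ℓ _ λ e rec → step e rec (kruskal? e)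
      where
      open IsStrictTotalOrder sto using () renaming (trans to ≺-trans)
      step : ∀ e → (∀ {g} → g ≺ e → Span (λ h → Kruskal h × (h ≺ g ⊎ h ≡ g)) g) →
             Dec (Kruskal e) → Span (λ g → Kruskal g × (g ≺ e ⊎ g ≡ e)) e
      step e rec (yes Te) = edge (Te , inj₂ refl)
      step e rec (no ¬Te) = bind (λ g≺e → mono (λ
        { (Th , inj₁ h≺g) → Th , inj₁ (≺-trans h≺g g≺e)
        ; (Th , inj₂ refl) → Th , inj₁ g≺e }) (rec g≺e))
        (decidable-stable (span? (_<? e) e) ¬Te)

    -- The ≺-largest edge of a circuit is spanned by smaller edges.
    kruskal-independent : ∀ {e} → Kruskal e → ¬ Span (Kruskal ⊝ e) e
    kruskal-independent {e} Te s = absurd (maximum sto (⊕? C? e) (inj₂ refl))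
      where
      open Circuit (circuit (⊝? kruskal? e) s)
      absurd : ¬ ∃ λ y → (C ⊕ e) y × (∀ {z} → (C ⊕ e) z → z ≢ y → z ≺ y)
      absurd (y , inj₁ Cy , max) = proj₁ (C⊆A Cy) (mono (λ
        { (inj₁ (Ch , h≢y)) → max (inj₁ Ch) h≢y
        ; (inj₂ refl) → max (inj₂ refl) (λ { refl → proj₂ (C⊆A Cy) refl }) }) (rotate Cy))
      absurd (.e , inj₂ refl , max) = Te (mono (λ Ch → max (inj₁ Ch) (proj₂ (C⊆A Ch))) spans)

  -- Spanning trees as bases of the graphic matroid

  Tree : Subset m → Set
  Tree T = (∀ e → Span (_∈ T) e) × (∀ {e} → e ∈ T → ¬ Span ((_∈ T) ⊝ e) e)

  walk⇒conn : ∀ {T u v es} → Walk ends T u v es → Conn (λ g → g ∈ T × g L.∈ es) u v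
  walk⇒conn stop = ε
  walk⇒conn (fwd e e∈T p r) =
    fwd′ e (e∈T , here refl) p (conn-mono (λ (g∈T , g∈es) → g∈T , there g∈es) (walk⇒conn r))
  walk⇒conn (bwd e e∈T p r) =
    bwd′ e (e∈T , here refl) p (conn-mono (λ (g∈T , g∈es) → g∈T , there g∈es) (walk⇒conn r))

  Trail : Subset m → EdgeSet → Fin n → Fin n → Set
  Trail T A u v = ∃ λ es → Walk ends T u v es × Unique es × All A es

  -- `Acyclic` speaks only of closed walks without repeated edges. If an edge about to be prepended
  -- already occurs, the walk is entered at that occurrence instead.
  trail-suffix : ∀ {T A x v es e u} → Walk ends T x v es → Unique es → All A es →
                 e L.∈ es → src e ≡ u ⊎ tgt e ≡ u → Trail T A u v
  trail-suffix (fwd e e∈T refl r) U@(_ ∷ _) A (here refl) (inj₁ refl) = _ , fwd e e∈T refl r , U , A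
  trail-suffix (fwd e e∈T refl r) (_ ∷ U) (_ ∷ A) (here refl) (inj₂ refl) = _ , r , U , A
  trail-suffix (bwd e e∈T refl r) (_ ∷ U) (_ ∷ A) (here refl) (inj₁ refl) = _ , r , U , A
  trail-suffix (bwd e e∈T refl r) U@(_ ∷ _) A (here refl) (inj₂ refl) = _ , bwd e e∈T refl r , U , A
  trail-suffix (fwd _ _ _ r) (_ ∷ U) (_ ∷ A) (there e∈es) p = trail-suffix r U A e∈es p
  trail-suffix (bwd _ _ _ r) (_ ∷ U) (_ ∷ A) (there e∈es) p = trail-suffix r U A e∈es p

  occurs : ∀ {e : Fin m} {es} → ¬ All (e ≢_) es → e L.∈ es
  occurs {e} {es} = Any.map (λ {g} → decidable-stable (e ≟ g)) ∘ ¬All⇒Any¬ (λ g → ¬? (e ≟ g)) es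

  conn⇒trail : ∀ {T A u v} → A ⊆ (_∈ T) → Conn A u v → Trail T A u v
  conn⇒trail A⊆T ε = [] , stop , [] , []
  conn⇒trail A⊆T (fwd′ e Ae p r) with conn⇒trail A⊆T r
  ... | es , w , U , As with All.all? (λ g → ¬? (e ≟ g)) es
  ...   | yes e∉es = e ∷ es , fwd e (A⊆T Ae) p w , e∉es ∷ U , Ae ∷ As
  ...   | no ¬e∉es = trail-suffix w U As (occurs ¬e∉es) (inj₁ p)
  conn⇒trail A⊆T (bwd′ e Ae p r) with conn⇒trail A⊆T r
  ... | es , w , U , As with All.all? (λ g → ¬? (e ≟ g)) es
  ...   | yes e∉es = e ∷ es , bwd e (A⊆T Ae) p w , e∉es ∷ U , Ae ∷ As
  ...   | no ¬e∉es = trail-suffix w U As (occurs ¬e∉es) (inj₂ p)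

  spanningTree⇒tree : ∀ {T} → SpanningTree ends T → Tree T
  spanningTree⇒tree {T} (conn , acyclic) =
    (λ e → conn-mono proj₁ (walk⇒conn (proj₂ (conn _ _)))) , λ {e} e∈T s →
    let es , w , U , es≢e = conn⇒trail proj₁ (reverse s)
    in acyclic (src e) e es (fwd e e∈T refl w , All.map (λ p e≡g → proj₂ p (sym e≡g)) es≢e ∷ U)

  tree⇒spanningTree : ∀ {T} → Connected ends ⊤ → Tree T → SpanningTree ends T
  tree⇒spanningTree {T} conn (spans , indep) = conn-T , acyclic
    where
    conn-T : Connected ends T
    conn-T u v =
      let es , w , _ = conn⇒trail id (conn-bind (λ {e} _ → spans e) (walk⇒conn (proj₂ (conn u v))))
      in es , w
    shrink : ∀ {e es} → All (e ≢_) es → (λ g → g ∈ T × g L.∈ es) ⊆ (_∈ T) ⊝ e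
    shrink e∉es (g∈T , g∈es) = g∈T , λ { refl → All.lookup e∉es g∈es refl }
    acyclic : Acyclic ends T
    acyclic v e es (fwd e e∈T refl r , e∉es ∷ _) =
      indep e∈T (reverse (conn-mono (shrink e∉es) (walk⇒conn r)))
    acyclic v e es (bwd e e∈T refl r , e∉es ∷ _) =
      indep e∈T (conn-mono (shrink e∉es) (walk⇒conn r))

-- Spanning trees and intervals

<⇒≱ : ∀ {p q} → p ℚ.< q → ¬ q ℚ.≤ p
<⇒≱ p<q q≤p = ℚ.<-irrefl refl (ℚ.<-≤-trans p<q q≤p)

wsum-remove : ∀ {m} {T : Subset m} {e} (w : Fin m → ℚ) → e ∈ T → wsum T w ≡ w e ℚ.+ wsum (T - e) w
wsum-remove {T = inside ∷ T} {zero} w here = cong (w zero ℚ.+_)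
  (trans (cong (λ s → wsum s (w ∘ suc)) (sym (p─⊥≡p T))) (sym (ℚ.+-identityˡ _)))
wsum-remove {T = b ∷ T} {suc e} w (there e∈T) = begin
  x ℚ.+ wsum T (w ∘ suc)                           ≡⟨ cong (x ℚ.+_) (wsum-remove (w ∘ suc) e∈T) ⟩
  x ℚ.+ (w (suc e) ℚ.+ wsum (T - e) (w ∘ suc))       ≡⟨ swap x (w (suc e)) _ ⟩
  w (suc e) ℚ.+ (x ℚ.+ wsum (T - e) (w ∘ suc))       ∎
  where
  open ≡-Reasoning
  x = if b then w zero else 0ℚ
  swap : ∀ x y z → x ℚ.+ (y ℚ.+ z) ≡ y ℚ.+ (x ℚ.+ z)
  swap x y z = trans (sym (ℚ.+-assoc x y z)) (trans (cong (ℚ._+ z) (ℚ.+-comm x y)) (ℚ.+-assoc y x z))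

x∈p-y⇒x≢y : ∀ {m} (p : Subset m) {x y} → x ∈ p - y → x ≢ y
x∈p-y⇒x≢y (_ ∷ p) {suc x} {suc .x} (there h) refl = x∈p-y⇒x≢y p h refl

x∈p-y⇒x∈p : ∀ {m} (p : Subset m) {x y} → x ∈ p - y → x ∈ p
x∈p-y⇒x∈p p {y = y} = p─q⊆p p ⁅ y ⁆

insert-remove : ∀ {m} (T : Subset m) {e} → e ∉ T → (T ∪ ⁅ e ⁆) - e ≡ T
insert-remove T {e} e∉T = ⊆-antisym to from
  where
  to : (T ∪ ⁅ e ⁆) - e S.⊆ T
  to h with x∈p∪q⁻ T ⁅ e ⁆ (x∈p-y⇒x∈p _ h)
  ... | inj₁ g∈T = g∈T
  ... | inj₂ g∈e = contradiction (x∈⁅y⁆⇒x≡y e g∈e) (x∈p-y⇒x≢y _ h)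
  from : T S.⊆ (T ∪ ⁅ e ⁆) - e
  from h = x∈p∧x≢y⇒x∈p-y (x∈p∪q⁺ (inj₁ h)) λ { refl → e∉T h }

wsum-insert : ∀ {m} (T : Subset m) {e} (w : Fin m → ℚ) → e ∉ T → wsum (T ∪ ⁅ e ⁆) w ≡ w e ℚ.+ wsum T w
wsum-insert T {e} w e∉T = trans (wsum-remove w (x∈p∪q⁺ {p = T} (inj₂ (x∈⁅x⁆ e))))
  (cong (λ s → w e ℚ.+ wsum s w) (insert-remove T e∉T))

subset : ∀ {m} {A : Pred (Fin m) 0ℓ} → Decidable A → Subset m
subset A? = tabulate (does ∘ A?)

∈-subset⁺ : ∀ {m} {A : Pred (Fin m) 0ℓ} (A? : Decidable A) {x} → A x → x ∈ subset A?
∈-subset⁺ A? {x} Ax = lookup⇒[]= x _ (trans (lookup∘tabulate _ x) (dec-true (A? x) Ax))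

∈-subset⁻ : ∀ {m} {A : Pred (Fin m) 0ℓ} (A? : Decidable A) {x} → x ∈ subset A? → A x
∈-subset⁻ A? {x} h with A? x | trans (sym (lookup∘tabulate (does ∘ A?) x)) ([]=⇒lookup h)
... | yes Ax | _ = Ax

-- `Kruskal` needs a strict total order, so equal keys are separated by a tag. The tag is a
-- parameter because `witness-exists` must break ties in a particular way.
module KeyOrder {m : ℕ} (key : Fin m → ℚ) (tag : Fin m → ℕ)
                (tag-injective : ∀ {x y} → tag x ≡ tag y → x ≡ y) where

  _≺_ : Fin m → Fin m → Set
  x ≺ y = key x ℚ.< key y ⊎ key x ≡ key y × tag x ℕ.< tag y

  ≺⇒≤ : ∀ {x y} → x ≺ y → key x ℚ.≤ key y
  ≺⇒≤ (inj₁ k<) = ℚ.<⇒≤ k<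
  ≺⇒≤ (inj₂ (k≡ , _)) = ℚ.≤-reflexive k≡

  ≺-isStrictTotalOrder : IsStrictTotalOrder _≡_ _≺_
  ≺-isStrictTotalOrder = record
    { isStrictPartialOrder = record
      { isEquivalence = isEquivalence
      ; irrefl = λ { refl → irrefl }
      ; trans = ≺-trans
      ; <-resp-≈ = (λ { refl h → h }) , λ { refl h → h } }
    ; compare = compare }
    where
    irrefl : ∀ {x} → ¬ x ≺ x
    irrefl (inj₁ k<) = ℚ.<-irrefl refl k<
    irrefl (inj₂ (_ , t<)) = ℕ.<-irrefl refl t<
    ≺-trans : ∀ {x y z} → x ≺ y → y ≺ z → x ≺ z
    ≺-trans (inj₁ p) (inj₁ q) = inj₁ (ℚ.<-trans p q)
    ≺-trans {x} (inj₁ p) (inj₂ (q , _)) = inj₁ (subst (key x ℚ.<_) q p)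
    ≺-trans {z = z} (inj₂ (p , _)) (inj₁ q) = inj₁ (subst (ℚ._< key z) (sym p) q)
    ≺-trans (inj₂ (p , s)) (inj₂ (q , t)) = inj₂ (trans p q , ℕ.<-trans s t)
    asym : ∀ {x y} → x ≺ y → ¬ y ≺ x
    asym p q = irrefl (≺-trans p q)
    below : ∀ {x y} → x ≺ y → Tri (x ≺ y) (x ≡ y) (y ≺ x)
    below p = tri< p (λ { refl → irrefl p }) (asym p)
    above : ∀ {x y} → y ≺ x → Tri (x ≺ y) (x ≡ y) (y ≺ x)
    above p = tri> (asym p) (λ { refl → irrefl p }) p
    compare : ∀ x y → Tri (x ≺ y) (x ≡ y) (y ≺ x)
    compare x y with ℚ.<-cmp (key x) (key y)
    ... | tri< k< _ _ = below (inj₁ k<)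
    ... | tri> _ _ k> = above (inj₁ k>)
    ... | tri≈ _ k≡ _ with ℕ.<-cmp (tag x) (tag y)
    ...   | tri< t< _ _ = below (inj₂ (k≡ , t<))
    ...   | tri> _ _ t> = above (inj₂ (sym k≡ , t>))
    ...   | tri≈ _ t≡ _ with tag-injective t≡
    ...     | refl = tri≈ irrefl refl irrefl

lower≤ : ∀ {x} J → x ∈I J → lower J ℚ.≤ x
lower≤ (opn L U) (L<x , _) = ℚ.<⇒≤ L<x
lower≤ (pt a) refl = ℚ.≤-refl

≤upper : ∀ {x} J → x ∈I J → x ℚ.≤ upper J
≤upper (opn L U) (_ , x<U) = ℚ.<⇒≤ x<U
≤upper (pt a) refl = ℚ.≤-refl

lower≤upper : ∀ {x} J → x ∈I J → lower J ℚ.≤ upper J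
lower≤upper J x∈J = ℚ.≤-trans (lower≤ J x∈J) (≤upper J x∈J)

-- An open interval attains neither of its ends.
∈I-below : ∀ {x u} J → x ∈I J → lower J ℚ.< u → upper J ℚ.≤ u → x ℚ.< u
∈I-below (opn L U) (_ , x<U) _ U≤u = ℚ.<-≤-trans x<U U≤u
∈I-below (pt a) refl a<u _ = a<u

∈I-above : ∀ {x l} J → x ∈I J → l ℚ.< upper J → l ℚ.≤ lower J → l ℚ.< x
∈I-above (opn L U) (L<x , _) _ l≤L = ℚ.≤-<-trans l≤L L<x
∈I-above (pt a) refl l<a _ = l<a

⊔-lub-< : ∀ {p q r} → p ℚ.< r → q ℚ.< r → p ⊔ q ℚ.< r
⊔-lub-< {p} {q} {r} p<r q<r with ℚ.⊔-sel p q
... | inj₁ eq = subst (ℚ._< r) (sym eq) p<r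
... | inj₂ eq = subst (ℚ._< r) (sym eq) q<r

⊓-glb-< : ∀ {p q r} → r ℚ.< p → r ℚ.< q → r ℚ.< p ⊓ q
⊓-glb-< {p} {q} {r} r<p r<q with ℚ.⊓-sel p q
... | inj₁ eq = subst (r ℚ.<_) (sym eq) r<p
... | inj₂ eq = subst (r ℚ.<_) (sym eq) r<q

exceed : ∀ J {z} → ValidInterval J → z ℚ.< upper J → ∃ λ x → x ∈I J × z ℚ.< x
exceed (opn L U) {z} L<U z<U with ℚ.<-dense (⊔-lub-< L<U z<U)
... | x , ⊔<x , x<U = x , (ℚ.≤-<-trans (ℚ.p≤p⊔q L z) ⊔<x , x<U) , ℚ.≤-<-trans (ℚ.p≤q⊔p L z) ⊔<x
exceed (pt a) _ z<a = a , refl , z<a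

undercut : ∀ J {z} → ValidInterval J → lower J ℚ.< z → ∃ λ x → x ∈I J × x ℚ.< z
undercut (opn L U) {z} L<U L<z with ℚ.<-dense (⊓-glb-< L<U L<z)
... | x , L<x , x<⊓ = x , (L<x , ℚ.<-≤-trans x<⊓ (ℚ.p⊓q≤p U z)) , ℚ.<-≤-trans x<⊓ (ℚ.p⊓q≤q U z)
undercut (pt a) _ a<z = a , refl , a<z

-- Certificates for a common minimum spanning tree

module MST {n m : ℕ} (ends : Ends n m) where
  open Graph ends

  swap : Subset m → Fin m → Fin m → Subset m
  swap T g e = (T - g) ∪ ⁅ e ⁆

  ∈-swap⁺ : ∀ {T g e h} → h ∈ T → h ≢ g → h ∈ swap T g e
  ∈-swap⁺ h∈T h≢g = x∈p∪q⁺ (inj₁ (x∈p∧x≢y⇒x∈p-y h∈T h≢g))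

  ∈-swap⁻ : ∀ {T g e h} → h ∈ swap T g e → (h ∈ T × h ≢ g) ⊎ h ≡ e
  ∈-swap⁻ {T} {g} {e} h∈ with x∈p∪q⁻ (T - g) ⁅ e ⁆ h∈
  ... | inj₁ p = inj₁ (x∈p-y⇒x∈p T p , x∈p-y⇒x≢y T p)
  ... | inj₂ p = inj₂ (x∈⁅y⁆⇒x≡y e p)

  -- If an edge `h` other than `e` were spanned by the rest of the new set, `exchange` would either
  -- make `h` dependent in `T` or show that `T` without `g` spans `e`.
  swap-tree : ∀ {T g e} → Tree T → g ∈ T → ¬ Span ((_∈ T) ⊝ g) e → Tree (swap T g e)
  swap-tree {T} {g} {e} (spans , indep) g∈T ¬s = spans′ , λ {h} → indep′ {h}
    where
    T′ = swap T g e
    into : (_∈ T) ⊝ g ⊕ e ⊆ (_∈ T′)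
    into (inj₁ (h∈T , h≢g)) = ∈-swap⁺ h∈T h≢g
    into (inj₂ refl) = x∈p∪q⁺ {p = T - g} (inj₂ (x∈⁅x⁆ e))
    old : (_∈ T) ⊆ Span (_∈ T′)
    old {h} h∈T with h ≟ g
    ... | yes refl = mono into (exchange′ g∈T (spans e) ¬s)
    ... | no h≢g = edge (∈-swap⁺ h∈T h≢g)
    spans′ : ∀ h → Span (_∈ T′) h
    spans′ h = bind old (spans h)
    indep′ : ∀ {h} → h ∈ T′ → ¬ Span ((_∈ T′) ⊝ h) h
    indep′ {h} h∈ s with h ≟ e
    ... | yes refl = ¬s (mono (λ { (k∈ , k≢e) → [ id , (λ k≡e → contradiction k≡e k≢e) ] (∈-swap⁻ k∈) }) s)
    ... | no h≢e with ∈-swap⁻ h∈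
    ...   | inj₂ h≡e = h≢e h≡e
    ...   | inj₁ (h∈T , h≢g) with exchange {(_∈ T) ⊝ g ⊝ h} (mono shift s)
      where
      shift : (_∈ T′) ⊝ h ⊆ (_∈ T) ⊝ g ⊝ h ⊕ e
      shift (k∈ , k≢h) with ∈-swap⁻ k∈
      ... | inj₁ p = inj₁ (p , k≢h)
      ... | inj₂ k≡e = inj₂ k≡e
    ...     | inj₁ t = indep h∈T (mono (λ { ((k∈ , _) , k≢h) → k∈ , k≢h }) t)
    ...     | inj₂ t = ¬s (mono (λ { (inj₁ (p , _)) → p ; (inj₂ refl) → h∈T , h≢g }) t)

  wsum-swap : ∀ {T g e} (w : Fin m → ℚ) → g ∈ T → ¬ Span ((_∈ T) ⊝ g) e →
              ∃ λ r → wsum T w ≡ w g ℚ.+ r × wsum (swap T g e) w ≡ w e ℚ.+ r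
  wsum-swap {T} {g} w g∈T ¬s = wsum (T - g) w , wsum-remove w g∈T ,
    wsum-insert (T - g) w λ e∈ → ¬s (edge (x∈p-y⇒x∈p T e∈ , x∈p-y⇒x≢y T e∈))

  -- `T′` is turned into `T` by swaps that never raise the weight. Each one removes an edge outside
  -- `T`, so the size of `T′ ─ T` serves as measure.
  cycle-property⇒minimal : ∀ {T} {w : Fin m → ℚ} → Tree T →
    (∀ f → Span (λ g → g ∈ T × w g ℚ.≤ w f) f) → ∀ T′ → Tree T′ → wsum T w ℚ.≤ wsum T′ w
  cycle-property⇒minimal {T} {w} (_ , indep) cyc = λ T′ → go T′ (<-wellFounded _)
    where
    go : ∀ T′ → WF.Acc ℕ._<_ ∣ T′ ─ T ∣ → Tree T′ → wsum T w ℚ.≤ wsum T′ w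
    go T′ (WF.acc rec) tr with any? (λ f → (f ∈? T′) ×-dec ¬? (f ∈? T))
    ... | no none = ℚ.≤-reflexive (cong (λ s → wsum s w) (⊆-antisym T⊆T′ T′⊆T))
      where
      T′⊆T : T′ S.⊆ T
      T′⊆T {f} f∈T′ = decidable-stable (f ∈? T) (λ f∉T → none (f , f∈T′ , f∉T))
      T⊆T′ : T S.⊆ T′
      T⊆T′ {f} f∈T = decidable-stable (f ∈? T′) λ f∉T′ →
        indep f∈T (mono (λ g∈T′ → T′⊆T g∈T′ , λ { refl → f∉T′ g∈T′ }) (proj₁ tr f))
    -- `T′` without `f` does not span `f`, but the edges of `T` that are no heavier do, so one of
    -- them can replace `f`.
    ... | yes (f , f∈T′ , f∉T)
        with unspanned-edge (λ g → (g ∈? T) ×-dec (w g ℚ.≤? w f)) (⊝? (_∈? T′) f) (cyc f) (proj₂ tr f∈T′)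
    ... | g , (g∈T , wg≤wf) , ¬s with wsum-swap w f∈T′ ¬s
    ... | r , eq , eq′ = ℚ.≤-trans (go (swap T′ f g) (rec smaller) (swap-tree tr f∈T′ ¬s))
          (subst₂ ℚ._≤_ (sym eq′) (sym eq) (ℚ.+-monoˡ-≤ r wg≤wf))
      where
      smaller : ∣ swap T′ f g ─ T ∣ ℕ.< ∣ T′ ─ T ∣
      smaller = p⊂q⇒∣p∣<∣q∣ (sub , f , x∈p∧x∉q⇒x∈p─q f∈T′ f∉T , f∉)
        where
        x∈p─q⇒x∉q : ∀ {k} (p q : Subset k) {x} → x ∈ p ─ q → x ∉ q
        x∈p─q⇒x∉q (_ ∷ p) (inside ∷ q) (there x∈) (there x∈q) = x∈p─q⇒x∉q p q x∈ x∈q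
        x∈p─q⇒x∉q (_ ∷ p) (outside ∷ q) (there x∈) (there x∈q) = x∈p─q⇒x∉q p q x∈ x∈q
        sub : swap T′ f g ─ T S.⊆ T′ ─ T
        sub h∈ with ∈-swap⁻ (p─q⊆p _ T h∈)
        ... | inj₁ (h∈T′ , _) = x∈p∧x∉q⇒x∈p─q h∈T′ (x∈p─q⇒x∉q _ T h∈)
        ... | inj₂ refl = contradiction g∈T (x∈p─q⇒x∉q _ T h∈)
        f∉ : f ∉ swap T′ f g ─ T
        f∉ f∈ with ∈-swap⁻ (p─q⊆p _ T f∈)
        ... | inj₁ (_ , f≢f) = f≢f refl
        ... | inj₂ refl = f∉T g∈T

  Intervals : Set
  Intervals = Fin m → Interval

  Real : Intervals → (Fin m → ℚ) → Set
  Real J w = ∀ e → w e ∈I J e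

  -- `Out` is the red rule: `e` closes a cycle with edges that are never heavier. `In` is the blue
  -- rule: `e` crosses a cut whose other edges are never lighter.
  Open Out In : Intervals → Fin m → Set
  Open J e = lower (J e) ℚ.< upper (J e)
  Out J e = Span (λ g → g ≢ e × upper (J g) ℚ.≤ lower (J e)) e
  In J e = ¬ Span (λ g → g ≢ e × lower (J g) ℚ.< upper (J e)) e

  Good : Intervals → Set
  Good J = ∀ e → Open J e → Out J e ⊎ In J e

  out? : ∀ J → Decidable (Out J)
  out? J e = span? (λ g → ¬? (g ≟ e) ×-dec (upper (J g) ℚ.≤? lower (J e))) e

  in? : ∀ J → Decidable (In J)
  in? J e = ¬? (span? (λ g → ¬? (g ≟ e) ×-dec (lower (J g) ℚ.<? upper (J e))) e)

  good? : ∀ J → Dec (Good J)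
  good? J = all? λ e → case e (lower (J e) ℚ.<? upper (J e))
    where
    case : ∀ e → Dec (Open J e) → Dec (Open J e → Out J e ⊎ In J e)
    case e (no ¬o) = yes λ o → contradiction o ¬o
    case e (yes o) = Dec.map′ (λ p _ → p) (λ f → f o) (out? J e ⊎-dec in? J e)

  -- Kruskal's tree for one realisation `w` is minimum for all of them: a nontree edge is spanned by
  -- tree edges whose intervals end before its own begins, which gives the cycle property for every
  -- `w′`.
  good⇒tree : ∀ {J w} → Good J → Real J w →
    ∃ λ T → Tree T × (∀ w′ → Real J w′ → ∀ T′ → Tree T′ → wsum T w′ ℚ.≤ wsum T′ w′)
  good⇒tree {J} {w} good real = T , (spans , λ {e} → indep {e}) , minimal
    where
    open KeyOrder w toℕ toℕ-injective
    K = Kruskal ≺-isStrictTotalOrder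
    K? = kruskal? ≺-isStrictTotalOrder
    T = subset K?
    below : ∀ e → Span (λ g → K g × w g ℚ.≤ w e) e
    below e = mono (λ { (Kg , inj₁ g≺e) → Kg , ≺⇒≤ g≺e ; (Kg , inj₂ refl) → Kg , ℚ.≤-refl })
                   (kruskal-spans ≺-isStrictTotalOrder e)
    spans : ∀ e → Span (_∈ T) e
    spans e = mono (∈-subset⁺ K? ∘ proj₁) (below e)
    indep : ∀ {e} → e ∈ T → ¬ Span ((_∈ T) ⊝ e) e
    indep e∈T s = kruskal-independent ≺-isStrictTotalOrder (∈-subset⁻ K? e∈T)
      (mono (λ { (g∈T , g≢e) → ∈-subset⁻ K? g∈T , g≢e }) s)
    lo≤ : ∀ e → lower (J e) ℚ.≤ w e
    lo≤ e = lower≤ (J e) (real e)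
    ≤up : ∀ e → w e ℚ.≤ upper (J e)
    ≤up e = ≤upper (J e) (real e)
    -- At first only the weights of the tree edges under `w` are bounded. `In` is impossible here,
    -- because lighter tree edges span `f`.
    below-lower : ∀ {f} → ¬ K f → Span (λ g → K g × w g ℚ.≤ lower (J f)) f
    below-lower {f} ¬Kf with lower (J f) ℚ.<? upper (J f)
    ... | no ¬o = mono (λ { (Kg , wg≤) → Kg , ℚ.≤-trans wg≤ (ℚ.≤-trans (≤up f) (ℚ.≮⇒≥ ¬o)) }) (below f)
    ... | yes o with good f o
    ...   | inj₁ out = bind (λ { {g} (_ , ug≤lf) →
              mono (λ { (Kh , wh≤) → Kh , ℚ.≤-trans wh≤ (ℚ.≤-trans (≤up g) ug≤lf) }) (below g) }) out
    ...   | inj₂ ¬s = contradiction (mono (λ { {g} (Kg , wg≤) →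
              (λ { refl → ¬Kf Kg }) ,
              ℚ.≤-<-trans (ℚ.≤-trans (lo≤ g) wg≤) (∈I-below (J f) (real f) o ℚ.≤-refl) }) (below f)) ¬s
    separated : ∀ {f} → ¬ K f → Span (λ g → K g × upper (J g) ℚ.≤ lower (J f)) f
    separated {f} ¬Kf = mono (λ { {h} ((Kh , wh≤) , s) → Kh , ub h Kh wh≤ s })
      (span-circuit A? (below-lower ¬Kf))
      where
      A : EdgeSet
      A g = K g × w g ℚ.≤ lower (J f)
      A? : Decidable A
      A? g = K? g ×-dec (w g ℚ.≤? lower (J f))
      -- If the interval of `h` reached above `lower (J f)`, it would be open. Then `Out` would make
      -- `h` dependent in the tree, and `In` fails because `f` and the other edges of `A` span `h`.
      ub : ∀ h → K h → w h ℚ.≤ lower (J f) → Span (A ⊝ h ⊕ f) h → upper (J h) ℚ.≤ lower (J f)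
      ub h Kh wh≤ s with upper (J h) ℚ.≤? lower (J f)
      ... | yes p = p
      ... | no ¬p with good h (ℚ.≤-<-trans (ℚ.≤-trans (lo≤ h) wh≤) (ℚ.≰⇒> ¬p))
      ...   | inj₁ out = contradiction (bind (λ { {g} (_ , ug≤lh) → mono (λ { {k} (Kk , wk≤) → Kk , λ { refl →
                <⇒≱ (∈I-above (J h) (real h) (ℚ.≤-<-trans (ℚ.≤-trans (lo≤ h) wh≤) (ℚ.≰⇒> ¬p)) ℚ.≤-refl)
                  (ℚ.≤-trans wk≤ (ℚ.≤-trans (≤up g) ug≤lh)) } }) (below g) }) out)
                (kruskal-independent ≺-isStrictTotalOrder Kh)
      ...   | inj₂ ¬s = contradiction (mono (λ
                { {g} (inj₁ ((_ , wg≤) , g≢h)) → g≢h , ℚ.≤-<-trans (ℚ.≤-trans (lo≤ g) wg≤) (ℚ.≰⇒> ¬p)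
                ; (inj₂ refl) → (λ { refl → ¬Kf Kh }) , ℚ.≰⇒> ¬p }) s) ¬s
    minimal : ∀ w′ → Real J w′ → ∀ T′ → Tree T′ → wsum T w′ ℚ.≤ wsum T′ w′
    minimal w′ real′ = cycle-property⇒minimal (spans , λ {e} → indep {e}) cyc
      where
      cyc : ∀ f → Span (λ g → g ∈ T × w′ g ℚ.≤ w′ f) f
      cyc f with K? f
      ... | yes Kf = edge (∈-subset⁺ K? Kf , ℚ.≤-refl)
      ... | no ¬Kf = mono (λ { {g} (Kg , ug≤lf) → ∈-subset⁺ K? Kg ,
              ℚ.≤-trans (≤upper (J g) (real′ g)) (ℚ.≤-trans ug≤lf (lower≤ (J f) (real′ f))) }) (separated ¬Kf)

  -- A tree edge that is not `In`, or an open nontree edge that is not `Out`, would allow a swap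
  -- that lowers the weight for some realisation.
  tree⇒good : ∀ {J w} → (∀ e → ValidInterval (J e)) → Real J w → ∀ {T} → Tree T →
    (∀ w′ → Real J w′ → ∀ T′ → Tree T′ → wsum T w′ ℚ.≤ wsum T′ w′) → Good J
  tree⇒good {J} {w} valid real {T} tree@(spans , indep) minimal e o = decide (e ∈? T)
    where
    -- A value `x` of `e` above `lower (J g)` and a value `y` of `g` below `x` make the swap
    -- strictly cheaper.
    no-gain : ∀ {e g} → e ∈ T → g ≢ e → ¬ Span ((_∈ T) ⊝ e) g → ¬ lower (J g) ℚ.< upper (J e)
    no-gain {e} {g} e∈T g≢e ¬s lg<ue with exceed (J e) (valid e) lg<ue
    ... | x , x∈ , lg<x with undercut (J g) (valid g) lg<x
    ... | y , y∈ , y<x with wsum-swap w′ e∈T ¬s | minimal w′ real′ _ (swap-tree tree e∈T ¬s)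
      where
      w′ : Fin m → ℚ
      w′ h with h ≟ e | h ≟ g
      ... | yes _ | _ = x
      ... | no _ | yes _ = y
      ... | no _ | no _ = w h
      real′ : Real J w′
      real′ h with h ≟ e | h ≟ g
      ... | yes refl | _ = x∈
      ... | no _ | yes refl = y∈
      ... | no _ | no _ = real h
    ... | r , eq , eq′ | le with e ≟ e | g ≟ e | g ≟ g
    ... | no e≢e | _ | _ = e≢e refl
    ... | _ | yes g≡e | _ = g≢e g≡e
    ... | _ | _ | no g≢g = g≢g refl
    ... | yes _ | no _ | yes _ = <⇒≱ (ℚ.+-monoˡ-< r y<x) (subst₂ ℚ._≤_ eq eq′ le)
    decide : Dec (e ∈ T) → Out J e ⊎ In J e
    decide (yes e∈T) = inj₂ λ s →
      let g , (g≢e , lg<ue) , ¬s = unspanned-edge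
            (λ g → ¬? (g ≟ e) ×-dec (lower (J g) ℚ.<? upper (J e))) (⊝? (_∈? T) e) s (indep e∈T)
      in no-gain e∈T g≢e ¬s lg<ue
    -- Some tree edge `g` on the circuit of `e` may be heavier than `e`; here `g` leaves and `e`
    -- enters.
    decide (no e∉T) with out? J e
    ... | yes out = inj₁ out
    ... | no ¬out with unspanned-edge
            (λ g → (g ∈? T) ×-dec span? (⊕? (⊝? (_∈? T) g) e) g)
            (λ g → ¬? (g ≟ e) ×-dec (upper (J g) ℚ.≤? lower (J e)))
            (span-circuit (_∈? T) (spans e)) ¬out
    ...   | g , (g∈T , s) , ¬t = contradiction
            (ℚ.≰⇒> λ ug≤le → ¬t (edge ((λ { refl → e∉T g∈T }) , ug≤le)))
            (no-gain g∈T (λ { refl → e∉T g∈T })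
              λ u → indep g∈T (bind (λ { (inj₁ p) → edge p ; (inj₂ refl) → u }) s))

-- Witness pairs

module Witness {n m : ℕ} (ends : Ends n m) where
  open Graph ends
  open MST ends

  -- Both conditions survive every refinement of J that keeps the intervals of e and f:
  -- e is not In because it stays the largest edge of a cycle, and not Out because
  -- no edge that can be as small as e helps to span it.
  record IsWitness (J : Intervals) (e f : Fin m) : Set where
    field
      open-e   : Open J e
      open-f   : Open J f
      cyclic   : Span (λ g → g ≢ e × lower (J g) ℚ.< upper (J e) × (upper (J g) ℚ.≤ upper (J e) ⊎ g ≡ f)) e
      unspanned : ¬ Span (λ g → g ≢ e × (lower (J g) ℚ.< lower (J e) ⊎ upper (J g) ℚ.≤ lower (J e))) e

  isWitness? : ∀ J e f → Dec (IsWitness J e f)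
  isWitness? J e f = Dec.map′
    (λ (a , b , c , d) → record { open-e = a ; open-f = b ; cyclic = c ; unspanned = d })
    (λ r → let open IsWitness r in open-e , open-f , cyclic , unspanned)
    ((lower (J e) ℚ.<? upper (J e)) ×-dec (lower (J f) ℚ.<? upper (J f)) ×-dec
     span? (λ g → ¬? (g ≟ e) ×-dec (lower (J g) ℚ.<? upper (J e)) ×-dec
                  ((upper (J g) ℚ.≤? upper (J e)) ⊎-dec (g ≟ f))) e ×-dec
     ¬? (span? (λ g → ¬? (g ≟ e) ×-dec
                  ((lower (J g) ℚ.<? lower (J e)) ⊎-dec (upper (J g) ℚ.≤? lower (J e)))) e))

  Refines : Intervals → Intervals → Set
  Refines J′ J = ∀ g → J′ g ≡ J g ⊎ ∃ λ x → x ∈I J g × J′ g ≡ pt x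

  -- This makes every solving query set contain `e` or `f`: without both, their intervals remain as
  -- they are.
  witness-hit : ∀ {J J′ e f} → Refines J′ J → IsWitness J e f →
                J′ e ≡ J e → J′ f ≡ J f → ¬ Good J′
  witness-hit {J} {J′} {e} {f} ref wit J′e J′f good
    with good e (subst (λ I → lower I ℚ.< upper I) (sym J′e) (IsWitness.open-e wit))
  ... | inj₁ out rewrite J′e = unspanned (mono (λ (g≢e , u≤l) → g≢e , small _ u≤l) out)
    where
    open IsWitness wit
    small : ∀ g → upper (J′ g) ℚ.≤ lower (J e) → lower (J g) ℚ.< lower (J e) ⊎ upper (J g) ℚ.≤ lower (J e)
    small g u≤l with ref g
    ... | inj₁ eq rewrite eq = inj₂ u≤l
    ... | inj₂ (x , x∈ , eq) rewrite eq with lower (J g) ℚ.<? lower (J e) | upper (J g) ℚ.≤? lower (J e)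
    ...   | yes p | _ = inj₁ p
    ...   | no _ | yes q = inj₂ q
    ...   | no ¬p | no ¬q = contradiction u≤l (<⇒≱ (∈I-above (J g) x∈ (ℚ.≰⇒> ¬q) (ℚ.≮⇒≥ ¬p)))
  ... | inj₂ ¬s rewrite J′e = ¬s (mono (λ (g≢e , l<u , h) → g≢e , low _ l<u h) cyclic)
    where
    open IsWitness wit
    low : ∀ g → lower (J g) ℚ.< upper (J e) → upper (J g) ℚ.≤ upper (J e) ⊎ g ≡ f →
          lower (J′ g) ℚ.< upper (J e)
    low g l<u (inj₂ refl) rewrite J′f = l<u
    low g l<u (inj₁ u≤u) with ref g
    ... | inj₁ eq rewrite eq = l<u
    ... | inj₂ (x , x∈ , eq) rewrite eq = ∈I-below (J g) x∈ l<u u≤u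

  -- Edges are scanned by lower limit, as in Kruskal's algorithm. If every edge that closes a cycle
  -- in this scan is certainly largest on one such cycle, the scan certifies `Good`; otherwise the
  -- first exception yields a pair.
  witness-exists : ∀ {J} → (∀ e → lower (J e) ℚ.≤ upper (J e)) → ¬ Good J → ∃₂ (IsWitness J)
  witness-exists {J} l≤u ¬good = decide (any? conflict?)
    where
    lo up : Fin m → ℚ
    lo e = lower (J e)
    up e = upper (J e)
    offset : ∀ {P : Set} → Dec P → ℕ → ℕ
    offset (yes _) i = m ℕ.+ i
    offset (no _) i = i
    -- Among equal lower limits, trivial intervals come first.
    tag : Fin m → ℕ
    tag e = offset (lo e ℚ.<? up e) (toℕ e)
    tag-injective : ∀ {x y} → tag x ≡ tag y → x ≡ y
    tag-injective {x} {y} = go (lo x ℚ.<? up x) (lo y ℚ.<? up y)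
      where
      go : ∀ {P Q : Set} (d : Dec P) (d′ : Dec Q) → offset d (toℕ x) ≡ offset d′ (toℕ y) → x ≡ y
      go (yes _) (yes _) eq = toℕ-injective (ℕ.+-cancelˡ-≡ m _ _ eq)
      go (no _) (no _) eq = toℕ-injective eq
      go (yes _) (no _) eq = contradiction (toℕ<n y) (ℕ.≤⇒≯ (subst (m ℕ.≤_) eq (ℕ.m≤m+n m _)))
      go (no _) (yes _) eq = contradiction (toℕ<n x) (ℕ.≤⇒≯ (subst (m ℕ.≤_) (sym eq) (ℕ.m≤m+n m _)))
    tag-< : ∀ {x y} → ¬ Open J x → Open J y → tag x ℕ.< tag y
    tag-< {x} {y} ¬o o = go (lo x ℚ.<? up x) (lo y ℚ.<? up y)
      where
      go : (d : Dec (Open J x)) (d′ : Dec (Open J y)) → offset d (toℕ x) ℕ.< offset d′ (toℕ y)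
      go (yes p) _ = contradiction p ¬o
      go (no _) (no ¬p) = contradiction o ¬p
      go (no _) (yes _) = ℕ.≤-trans (toℕ<n x) (ℕ.m≤m+n m _)
    open KeyOrder lo tag tag-injective
    module U = KeyOrder up toℕ toℕ-injective
    open IsStrictTotalOrder ≺-isStrictTotalOrder using (_<?_; irrefl)
      renaming (trans to ≺-trans; isStrictPartialOrder to spo)
    open IsStrictTotalOrder U.≺-isStrictTotalOrder using ()
      renaming (_<?_ to _<ᵘ?_; trans to ≺ᵘ-trans; irrefl to ≺ᵘ-irrefl)

    small⇒≺ : ∀ {g e} → Open J e → lo g ℚ.< lo e ⊎ up g ℚ.≤ lo e → g ≺ e
    small⇒≺ o (inj₁ p) = inj₁ p
    small⇒≺ {g} {e} o (inj₂ p) with lo g ℚ.<? lo e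
    ... | yes q = inj₁ q
    ... | no ¬q = inj₂ (ℚ.≤-antisym (ℚ.≤-trans (l≤u g) p) (ℚ.≮⇒≥ ¬q)
                       , tag-< (λ o′ → ¬q (ℚ.<-≤-trans o′ p)) o)

    Early : Fin m → EdgeSet
    Early f g = g ≺ f × up g ℚ.≤ lo f
    early? : ∀ f → Decidable (Early f)
    early? f g = (g <? f) ×-dec (up g ℚ.≤? lo f)
    Conflict : EdgeSet
    Conflict f = Span (_≺ f) f × ¬ Span (Early f) f
    conflict? : Decidable Conflict
    conflict? f = span? (_<? f) f ×-dec ¬? (span? (early? f) f)

    early : ∀ {f} → ¬ Conflict f → Span (_≺ f) f → Span (Early f) f
    early {f} ¬c s = decidable-stable (span? (early? f) f) (λ ¬t → ¬c (s , ¬t))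

    -- An edge `e` not spanned by smaller ones is in Kruskal's tree. By `lift`, the edges that may
    -- be lighter than `e` are spanned by tree edges other than `e`, so by independence they cannot
    -- span `e`.
    no-conflict⇒good : (∀ f → ¬ Conflict f) → Good J
    no-conflict⇒good ¬c e o with span? (_<? e) e
    ... | yes s = inj₁ (mono (λ (g≺e , u≤l) → (λ g≡e → irrefl g≡e g≺e) , u≤l) (early (¬c e) s))
    ... | no ¬s = inj₂ λ s → kruskal-independent ≺-isStrictTotalOrder ¬s
            (mono (λ (Kh , h≢e , _) → Kh , h≢e) (bind (λ {g} (g≢e , l<u) → lift g g≢e l<u) s))
      where
      K = Kruskal ≺-isStrictTotalOrder
      B : EdgeSet
      B h = K h × h ≢ e × lo h ℚ.< up e
      lift : ∀ g → g ≢ e → lo g ℚ.< up e → Span B g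
      lift = WF.All.wfRec (spo-wellFounded spo) 0ℓ _ step
        where
        step : ∀ g → (∀ {h} → h ≺ g → h ≢ e → lo h ℚ.< up e → Span B h) → g ≢ e → lo g ℚ.< up e → Span B g
        step g rec g≢e l<u with span? (_<? g) g
        ... | no Kg = edge (Kg , g≢e , l<u)
        ... | yes t = bind (λ {h} (h≺g , u≤l) → let uh<ue = ℚ.≤-<-trans u≤l l<u in
                rec h≺g (λ { refl → ℚ.<-irrefl refl uh<ue }) (ℚ.≤-<-trans (l≤u h) uh<ue)) (early (¬c g) t)

    earlier : ∀ f → Span (_≺ f) f → ¬ Span (Early f) f → ∃ (_≺ f)
    earlier f s ¬early with any? (_<? f)
    ... | yes found = found
    ... | no none = contradiction (mono (λ g≺f → contradiction (_ , g≺f) none) s) ¬early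

    -- f is the first conflict in the order of lower limits, and e is the last edge, in the order
    -- of upper limits, that is needed to join the ends of f by edges preceding f.
    decide : Dec (∃ Conflict) → ∃₂ (IsWitness J)
    decide (no ¬c) = contradiction (no-conflict⇒good λ f c → ¬c (f , c)) ¬good
    decide (yes (f₀ , c₀)) with minimum ≺-isStrictTotalOrder conflict? c₀
    ... | f , (spanned , ¬early) , first
        with maximum U.≺-isStrictTotalOrder (_<? f) (proj₂ (earlier f spanned ¬early))
    ... | t , t≺f , max = found (minimum U.≺-isStrictTotalOrder bottleneck? (mono top spanned))
      where
      Bottleneck : EdgeSet
      Bottleneck e = Span (λ g → g ≺ f × (g U.≺ e ⊎ g ≡ e)) f
      bottleneck? : Decidable Bottleneck
      bottleneck? e = span? (λ g → (g <? f) ×-dec ((g <ᵘ? e) ⊎-dec (g ≟ e))) f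
      top : ∀ {g} → g ≺ f → g ≺ f × (g U.≺ t ⊎ g ≡ t)
      top {g} g≺f with g ≟ t
      ... | yes p = g≺f , inj₂ p
      ... | no p = g≺f , inj₁ (max g≺f p)
      found : (∃ λ e → Bottleneck e × (∀ {z} → Bottleneck z → ¬ z U.≺ e)) → ∃₂ (IsWitness J)
      found (e , bn , min) = pair (lo f ℚ.<? up f)
        where
        Below : EdgeSet
        Below g = g ≺ f × g U.≺ e
        below? : Decidable Below
        below? g = (g <? f) ×-dec (g <ᵘ? e)
        -- Otherwise the largest edge of `Below` would be a smaller bottleneck.
        ¬below : ¬ Span Below f
        ¬below s with any? below?
        ... | no none = ¬early (mono (λ b → contradiction (_ , b) none) s)
        ... | yes (_ , b) with maximum U.≺-isStrictTotalOrder below? b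
        ...   | z , (_ , z≺e) , maxz = min (mono above s) z≺e
          where
          above : ∀ {g} → Below g → g ≺ f × (g U.≺ z ⊎ g ≡ z)
          above {g} b@(g≺f , _) with g ≟ z
          ... | yes p = g≺f , inj₂ p
          ... | no p = g≺f , inj₁ (maxz b p)
        e≺f : e ≺ f
        e≺f = decidable-stable (e <? f) λ e⊀f → ¬below (mono
          (λ { (g≺f , inj₁ g≺e) → g≺f , g≺e ; (g≺f , inj₂ refl) → contradiction g≺f e⊀f }) bn)
        -- Otherwise all edges up to the bottleneck would be `Early`, and `f` would be no conflict.
        lf<ue : lo f ℚ.< up e
        lf<ue = ℚ.≰⇒> λ ue≤lf → ¬early (mono
          (λ { (g≺f , inj₁ g≺e) → g≺f , ℚ.≤-trans (U.≺⇒≤ g≺e) ue≤lf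
             ; (g≺f , inj₂ refl) → g≺f , ue≤lf }) bn)
        e-open : Open J e
        e-open = ℚ.≤-<-trans (≺⇒≤ e≺f) lf<ue
        around : Span (Below ⊕ f) e
        around with exchange {Below} (mono (λ
          { (g≺f , inj₁ g≺e) → inj₁ (g≺f , g≺e) ; (_ , inj₂ g≡e) → inj₂ g≡e }) bn)
        ... | inj₁ s = contradiction s ¬below
        ... | inj₂ s = s
        cyclic : Span (λ g → g ≢ e × lo g ℚ.< up e × (up g ℚ.≤ up e ⊎ g ≡ f)) e
        cyclic = mono (λ
          { (inj₁ (g≺f , g≺e)) → (λ g≡e → ≺ᵘ-irrefl g≡e g≺e) , ℚ.≤-<-trans (≺⇒≤ g≺f) lf<ue , inj₁ (U.≺⇒≤ g≺e)
          ; (inj₂ refl) → (λ f≡e → irrefl (sym f≡e) e≺f) , lf<ue , inj₂ refl }) around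
        -- Edges as small as these precede `e`, which precedes the first conflict, so `e` is spanned
        -- by edges that end by `lo e`. Replacing `e` by them would avoid the bottleneck.
        unspanned : ¬ Span (λ g → g ≢ e × (lo g ℚ.< lo e ⊎ up g ℚ.≤ lo e)) e
        unspanned s = ¬below (bind (λ
          { (g≺f , inj₁ g≺e) → edge (g≺f , g≺e)
          ; (_ , inj₂ refl) → mono (λ (h≺e , u≤l) → ≺-trans h≺e e≺f , inj₁ (ℚ.≤-<-trans u≤l e-open))
              (early (λ c → first c e≺f) (mono (λ (_ , p) → small⇒≺ e-open p) s)) }) bn)
        pair : Dec (Open J f) → ∃₂ (IsWitness J)
        pair (yes o) = e , f , record
          { open-e = e-open ; open-f = o ; cyclic = cyclic ; unspanned = unspanned }
        -- A trivial `f` has its value below `up e`, so `cyclic` holds without the exception for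
        -- `f`, and `e` is paired with itself.
        pair (no ¬o) = e , e , record
          { open-e = e-open ; open-f = e-open ; unspanned = unspanned
          ; cyclic = mono (λ
            { (g≢e , l<u , inj₁ u≤u) → g≢e , l<u , inj₁ u≤u
            ; (g≢e , l<u , inj₂ refl) → g≢e , l<u , inj₁ (ℚ.<⇒≤ (ℚ.≤-<-trans (ℚ.≮⇒≥ ¬o) lf<ue)) }) cyclic }

-- Partly queried instances and transfer between weight assignments

module Cells {m : ℕ} (I : Fin m → Interval) where

  -- Answers become trivial intervals, so that `Good` applies to a partly queried instance as well.
  cell : Subset m → (Fin m → ℚ) → Fin m → Interval
  cell Q w e = if does (e ∈? Q) then pt (w e) else I e

  cell-∈ : ∀ Q w {e} → e ∈ Q → cell Q w e ≡ pt (w e)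
  cell-∈ Q w {e} e∈Q with e ∈? Q
  ... | yes _ = refl
  ... | no e∉Q = contradiction e∈Q e∉Q

  cell-∉ : ∀ Q w {e} → e ∉ Q → cell Q w e ≡ I e
  cell-∉ Q w {e} e∉Q with e ∈? Q
  ... | yes e∈Q = contradiction e∈Q e∉Q
  ... | no _ = refl

  -- The two comparisons that `Out` and `In` of `e` make with a queried weight. The implications run
  -- in opposite directions because `In` is a negated condition.
  SameSide : Fin m → ℚ → ℚ → Set
  SameSide e x y = (x ℚ.≤ lower (I e) → y ℚ.≤ lower (I e)) × (y ℚ.< upper (I e) → x ℚ.< upper (I e))

  sameRegion⇒sameSide : ∀ {e x y} → lower (I e) ℚ.< upper (I e) → Bool.T (sameRegion (I e) x y) →
                        SameSide e x y × SameSide e y x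
  sameRegion⇒sameSide {e} {x} {y} L<U same with Equivalence.to T-∨ same
  ... | inj₁ t with Equivalence.to T-∧ t
  ...   | p , q = ((λ _ → ℚ.≤ᵇ⇒≤ q) , λ _ → ℚ.≤-<-trans (ℚ.≤ᵇ⇒≤ p) L<U)
                , ((λ _ → ℚ.≤ᵇ⇒≤ p) , λ _ → ℚ.≤-<-trans (ℚ.≤ᵇ⇒≤ q) L<U)
  sameRegion⇒sameSide {e} {x} {y} L<U same | inj₂ t with Equivalence.to T-∨ t
  ... | inj₂ r with Equivalence.to T-∧ r
  ...   | p , q = ((λ x≤L → contradiction (ℚ.≤-trans (ℚ.≤ᵇ⇒≤ p) x≤L) (<⇒≱ L<U))
                  , λ y<U → contradiction (ℚ.≤ᵇ⇒≤ q) (<⇒≱ y<U))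
                , ((λ y≤L → contradiction (ℚ.≤-trans (ℚ.≤ᵇ⇒≤ q) y≤L) (<⇒≱ L<U))
                  , λ x<U → contradiction (ℚ.≤ᵇ⇒≤ p) (<⇒≱ x<U))
  sameRegion⇒sameSide {e} {x} {y} L<U same | inj₂ t | inj₁ r with Equivalence.to T-∧ r
  ... | p , q with Equivalence.to T-∧ p | Equivalence.to T-∧ q
  ...   | L<x , x<U | L<y , y<U = ((λ x≤L → contradiction x≤L (<⇒≱ (<ᵇ⇒< L<x))) , λ _ → <ᵇ⇒< x<U)
                                , ((λ y≤L → contradiction y≤L (<⇒≱ (<ᵇ⇒< L<y))) , λ _ → <ᵇ⇒< y<U)
    where
    <ᵇ⇒< : ∀ {p q} → Bool.T (p <ᵇ q) → p ℚ.< q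
    <ᵇ⇒< {p} {q} t with q ≤ᵇ p in eq
    <ᵇ⇒< () | true
    ... | false = ℚ.≰⇒> λ q≤p → subst Bool.T eq (ℚ.≤⇒≤ᵇ q≤p)

module Transfer {n m : ℕ} (ends : Ends n m) (I : Fin m → Interval) where
  open Graph ends
  open MST ends
  open Witness ends using (Refines)
  open Cells I

  -- For an unqueried `e`, `Out` persists since new answers do not exceed their upper limits, and
  -- `In` persists since they do not fall below their lower limits; `SameSide` handles the old
  -- answers.
  good-transfer : ∀ {Q Q′ w w′} → Q S.⊆ Q′ → (∀ e → w e ∈I I e) → (∀ e → w′ e ∈I I e) →
    (∀ {e f} → Open I e → e ∉ Q′ → f ∈ Q → f ≢ e → SameSide e (w f) (w′ f)) →
    Good (cell Q w) → Good (cell Q′ w′)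
  good-transfer {Q} {Q′} {w} {w′} Q⊆Q′ w∈ w′∈ same good e o with e ∈? Q′
  ... | yes _ = contradiction o (ℚ.<-irrefl refl)
  ... | no e∉Q′ with good e (subst (λ J → lower J ℚ.< upper J) (sym (cell-∉ Q w (e∉Q′ ∘ Q⊆Q′))) o)
  ...   | inj₁ out rewrite cell-∉ Q w (e∉Q′ ∘ Q⊆Q′) =
          inj₁ (mono (λ (g≢e , u≤l) → g≢e , up _ g≢e u≤l) out)
    where
    up : ∀ g → g ≢ e → upper (cell Q w g) ℚ.≤ lower (I e) → upper (cell Q′ w′ g) ℚ.≤ lower (I e)
    up g g≢e u≤l with g ∈? Q | g ∈? Q′
    ... | yes g∈Q | yes _ = proj₁ (same o e∉Q′ g∈Q g≢e) u≤l
    ... | yes g∈Q | no g∉Q′ = contradiction (Q⊆Q′ g∈Q) g∉Q′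
    ... | no _ | yes _ = ℚ.≤-trans (≤upper (I g) (w′∈ g)) u≤l
    ... | no _ | no _ = u≤l
  ...   | inj₂ ¬s rewrite cell-∉ Q w (e∉Q′ ∘ Q⊆Q′) =
          inj₂ λ s → ¬s (mono (λ (g≢e , l<u) → g≢e , low _ g≢e l<u) s)
    where
    low : ∀ g → g ≢ e → lower (cell Q′ w′ g) ℚ.< upper (I e) → lower (cell Q w g) ℚ.< upper (I e)
    low g g≢e l<u with g ∈? Q | g ∈? Q′
    ... | yes g∈Q | yes _ = proj₂ (same o e∉Q′ g∈Q g≢e) l<u
    ... | yes g∈Q | no g∉Q′ = contradiction (Q⊆Q′ g∈Q) g∉Q′
    ... | no _ | yes _ = ℚ.≤-<-trans (lower≤ (I g) (w′∈ g)) l<u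
    ... | no _ | no _ = l<u

  cell-refines : ∀ {Q Q′ w w′} → Q S.⊆ Q′ → (∀ e → w′ e ∈I I e) → (∀ {e} → e ∈ Q → w e ≡ w′ e) →
                 Refines (cell Q′ w′) (cell Q w)
  cell-refines {Q} {Q′} {w} {w′} Q⊆Q′ w′∈ agree g with g ∈? Q | g ∈? Q′
  ... | yes g∈Q | yes _ = inj₁ (cong pt (sym (agree g∈Q)))
  ... | yes g∈Q | no g∉Q′ = contradiction (Q⊆Q′ g∈Q) g∉Q′
  ... | no _ | yes _ = inj₂ (w′ g , w′∈ g , refl)
  ... | no _ | no _ = inj₁ refl

-- The algorithm

smallest : ∀ {m} {P : Subset m → Set} → Decidable P → ∃ P →
           ∃ λ Q → P Q × (∀ Q′ → P Q′ → ∣ Q ∣ ≤ ∣ Q′ ∣)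
smallest {m} {P} P? (Q , PQ) = go Q PQ (<-wellFounded _)
  where
  go : ∀ Q → P Q → WF.Acc ℕ._<_ ∣ Q ∣ → ∃ λ Q → P Q × (∀ Q′ → P Q′ → ∣ Q ∣ ≤ ∣ Q′ ∣)
  go Q PQ (WF.acc rec) with anySubset? (λ Q′ → P? Q′ ×-dec (∣ Q′ ∣ ℕ.<? ∣ Q ∣))
  ... | yes (Q′ , PQ′ , lt) = go Q′ PQ′ (rec lt)
  ... | no none = Q , PQ , λ Q′ PQ′ → ℕ.≮⇒≥ λ lt → none (Q′ , PQ′ , lt)

∣p∪q∣≤∣p∣+∣q∣ : ∀ {m} (p q : Subset m) → ∣ p ∪ q ∣ ≤ ∣ p ∣ + ∣ q ∣
∣p∪q∣≤∣p∣+∣q∣ [] [] = z≤n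
∣p∪q∣≤∣p∣+∣q∣ (outside ∷ p) (outside ∷ q) = ∣p∪q∣≤∣p∣+∣q∣ p q
∣p∪q∣≤∣p∣+∣q∣ (inside ∷ p) (outside ∷ q) = s≤s (∣p∪q∣≤∣p∣+∣q∣ p q)
∣p∪q∣≤∣p∣+∣q∣ (outside ∷ p) (inside ∷ q) =
  ℕ.≤-trans (s≤s (∣p∪q∣≤∣p∣+∣q∣ p q)) (ℕ.≤-reflexive (sym (ℕ.+-suc ∣ p ∣ ∣ q ∣)))
∣p∪q∣≤∣p∣+∣q∣ (inside ∷ p) (inside ∷ q) =
  s≤s (ℕ.≤-trans (∣p∪q∣≤∣p∣+∣q∣ p q) (ℕ.+-monoʳ-≤ ∣ p ∣ (ℕ.n≤1+n ∣ q ∣)))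

∩-mono-⊆ : ∀ {m} {p p′ q q′ : Subset m} → p S.⊆ p′ → q S.⊆ q′ → p ∩ q S.⊆ p′ ∩ q′
∩-mono-⊆ {p = p} {q = q} f g x∈ with x∈p∩q⁻ p q x∈
... | x∈p , x∈q = x∈p∩q⁺ (f x∈p , g x∈q)

∣∩∣-grows : ∀ {m} {p p′ q q′ : Subset m} {x} → p S.⊆ p′ → q S.⊆ q′ → x ∈ p′ → x ∈ q′ → x ∉ p ∩ q →
            ∣ p ∩ q ∣ ℕ.< ∣ p′ ∩ q′ ∣
∣∩∣-grows f g x∈p′ x∈q′ x∉ = p⊂q⇒∣p∣<∣q∣ (∩-mono-⊆ f g , _ , x∈p∩q⁺ (x∈p′ , x∈q′) , x∉)

f≤finSum : ∀ {m} (f : Fin m → ℕ) x → f x ≤ finSum f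
f≤finSum f zero = ℕ.m≤m+n _ _
f≤finSum f (suc x) = ℕ.≤-trans (f≤finSum (f ∘ suc) x) (ℕ.m≤n+m _ _)

∣p∣≤finSum : ∀ {m} (f : Fin m → ℕ) (p : Subset m) → (∀ {x} → x ∈ p → 1 ≤ f x) → ∣ p ∣ ≤ finSum f
∣p∣≤finSum f [] _ = z≤n
∣p∣≤finSum f (outside ∷ p) h = ℕ.≤-trans (∣p∣≤finSum (f ∘ suc) p (h ∘ there)) (ℕ.m≤n+m _ _)
∣p∣≤finSum f (inside ∷ p) h = ℕ.+-mono-≤ (h here) (∣p∣≤finSum (f ∘ suc) p (h ∘ there))

finSum-0 : ∀ m → finSum {m} (λ _ → 0) ≡ 0
finSum-0 zero = refl
finSum-0 (suc m) = finSum-0 m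

finSum-+ : ∀ {m} (f g : Fin m → ℕ) → finSum (λ x → f x + g x) ≡ finSum f + finSum g
finSum-+ {zero} f g = refl
finSum-+ {suc m} f g = trans (cong (f zero + g zero +_) (finSum-+ (f ∘ suc) (g ∘ suc)))
  (solve 4 (λ a b c d → a :+ b :+ (c :+ d) := a :+ c :+ (b :+ d)) refl (f zero) (g zero) _ _)
  where open +-*-Solver

finSum-comm : ∀ {k m} (f : Fin k → Fin m → ℕ) →
              finSum (λ x → finSum (f x)) ≡ finSum (λ y → finSum (λ x → f x y))
finSum-comm {zero} {m} f = sym (finSum-0 m)
finSum-comm {suc k} f = trans (cong (finSum (f zero) +_) (finSum-comm (f ∘ suc)))
  (sym (finSum-+ (f zero) (λ y → finSum (λ x → f (suc x) y))))

History : ℕ → Set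
History m = List (Fin m × ℚ)

module Algorithm (γ : ℕ) {n m : ℕ} (ends : Ends n m) (I : Fin m → Interval) (pred : Fin m → ℚ) where
  open Graph ends
  open MST ends
  open Witness ends
  open Cells I
  open Transfer ends I

  good-⊤ : ∀ w → Good (cell ⊤ w)
  good-⊤ w e o rewrite cell-∈ ⊤ w {e} ∈⊤ = contradiction o (ℚ.<-irrefl refl)

  optimalPlan : ∃ λ Q → Good (cell Q pred) × (∀ Q′ → Good (cell Q′ pred) → ∣ Q ∣ ≤ ∣ Q′ ∣)
  optimalPlan = smallest (λ Q → good? (cell Q pred)) (⊤ , good-⊤ pred)

  abstract
    plan : Subset m
    plan = proj₁ optimalPlan

    plan-good : Good (cell plan pred)
    plan-good = proj₁ (proj₂ optimalPlan)

    plan-minimal : ∀ Q → Good (cell Q pred) → ∣ plan ∣ ≤ ∣ Q ∣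
    plan-minimal = proj₂ (proj₂ optimalPlan)

  -- An unqueried edge keeps its prediction, so `target-good` can treat it as unchanged.
  val : History m → Fin m → ℚ
  val [] e = pred e
  val ((x , v) ∷ h) e with e ≟ x
  ... | yes _ = v
  ... | no _ = val h e

  state : History m → Intervals
  state h = cell (queried h) (val h)

  -- The marked edge is the one relative to which an answer changed region, not the mispredicted
  -- one: querying `e` removes its interval from the comparisons in `good-transfer`.
  Surprise : History m → Fin m → Set
  Surprise h e = Any (λ p → proj₁ p ≢ e × ¬ Bool.T (sameRegion (I e) (proj₂ p) (pred (proj₁ p)))) h

  surprise? : ∀ h → Decidable (Surprise h)
  surprise? h e = Any.any? (λ p → ¬? (proj₁ p ≟ e) ×-dec
    ¬? (Bool.T? (sameRegion (I e) (proj₂ p) (pred (proj₁ p))))) h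

  abstract
    target : History m → Subset m
    target h = plan ∪ subset (surprise? h)

    plan⊆target : ∀ h → plan S.⊆ target h
    plan⊆target h = p⊆p∪q (subset (surprise? h))

    surprise⇒target : ∀ h {e} → Surprise h e → e ∈ target h
    surprise⇒target h s = q⊆p∪q plan _ (∈-subset⁺ (surprise? h) s)

    target⁻ : ∀ h {e} → e ∈ target h → e ∈ plan ⊎ Surprise h e
    target⁻ h e∈ with x∈p∪q⁻ plan (subset (surprise? h)) e∈
    ... | inj₁ p = inj₁ p
    ... | inj₂ q = inj₂ (∈-subset⁻ (surprise? h) q)

  -- The edge to query is `a`, so it must be on target. The two roles in `IsWitness` differ, hence
  -- both orientations.
  Pair : History m → Fin m → Fin m → Set
  Pair h a b = a ∈ target h × (IsWitness (state h) a b ⊎ IsWitness (state h) b a)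

  pair? : ∀ h → Dec (∃₂ (Pair h))
  pair? h = any? λ a → any? λ b →
    (a ∈? target h) ×-dec (isWitness? (state h) a b ⊎-dec isWitness? (state h) b a)

  -- `phase` runs from 0 to `γ` within a group of `γ + 1` queries; at `γ` the closing query is due.
  phase groups : History m → ℕ
  phase [] = 0
  phase (_ ∷ h) with phase h ℕ.≟ γ
  ... | yes _ = 0
  ... | no _ = suc (phase h)
  groups [] = 0
  groups (_ ∷ h) with phase h ℕ.≟ γ
  ... | yes _ = suc (groups h)
  ... | no _ = groups h

  second : ∀ {h} → Dec (∃₂ (Pair h)) → Maybe (Fin m)
  second (yes (_ , b , _)) = just b
  second (no _) = nothing

  -- A history does not store pairs, so the partner of the last query is recovered by repeating the
  -- search on the history before it.
  companion : History m → Maybe (Fin m)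
  companion [] = nothing
  companion (_ ∷ h) = second (pair? h)

  unlessQueried : History m → Fin m → Maybe (Fin m) → Fin m
  -- A default value: when a group is about to close, `half-hit` provides a companion.
  unlessQueried h a nothing = a
  unlessQueried h a (just b) with b ∈? queried h
  -- The partner was unqueried before the last query, so it is that query itself, and every feasible
  -- set contains it. A fresh target edge then closes the group.
  ... | yes _ = a
  ... | no _ = b

  choose : ∀ h → Dec (Good (state h)) → Dec (∃₂ (Pair h)) → Dec (phase h ≡ γ) → Maybe (Fin m)
  choose h (yes _) _ _ = nothing
  -- By `pair-exists`, this case does not occur in a run.
  choose h (no _) (no _) _ = nothing
  choose h (no _) (yes (a , _)) (no _) = just a
  choose h (no _) (yes (a , _)) (yes _) = just (unlessQueried h a (companion h))

  next : History m → Maybe (Fin m)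
  next h = choose h (good? (state h)) (pair? h) (phase h ℕ.≟ γ)

  val-lookup : ∀ h {e} → e ∈ queried h → (e , val h e) L.∈ h
  val-lookup [] e∈ = contradiction e∈ ∉⊥
  val-lookup ((x , v) ∷ h) {e} e∈ with e ≟ x
  ... | yes refl = here refl
  ... | no e≢x with x∈p∪q⁻ ⁅ x ⁆ (queried h) e∈
  ...   | inj₁ p = contradiction (x∈⁅y⁆⇒x≡y x p) e≢x
  ...   | inj₂ q = there (val-lookup h q)

  val-default : ∀ h {e} → e ∉ queried h → val h e ≡ pred e
  val-default [] e∉ = refl
  val-default ((x , v) ∷ h) {e} e∉ with e ≟ x
  ... | yes refl = contradiction (x∈p∪q⁺ (inj₁ (x∈⁅x⁆ x))) e∉
  ... | no _ = val-default h (e∉ ∘ x∈p∪q⁺ {p = ⁅ x ⁆} ∘ inj₂)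

  target-mono : ∀ p h → target h S.⊆ target (p ∷ h)
  target-mono p h e∈ with target⁻ h e∈
  ... | inj₁ q = plan⊆target (p ∷ h) q
  ... | inj₂ q = surprise⇒target (p ∷ h) (there q)

  open⇒∉ : ∀ Q w {e} → Open (cell Q w) e → e ∉ Q
  open⇒∉ Q w {e} o e∈Q rewrite cell-∈ Q w {e} e∈Q = ℚ.<-irrefl refl o

  module Analysis (pred∈ : ∀ e → pred e ∈I I e) where

    val∈I : ∀ h → All (λ p → proj₂ p ∈I I (proj₁ p)) h → ∀ e → val h e ∈I I e
    val∈I h ok e with e ∈? queried h
    ... | yes e∈ = All.lookup ok (val-lookup h e∈)
    ... | no e∉ = subst (_∈I I e) (sym (val-default h e∉)) (pred∈ e)

    -- Relative to an edge outside the target, no answer has left its predicted region, so the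
    -- plan's certificate carries over to `val h`.
    target-good : ∀ h → All (λ p → proj₂ p ∈I I (proj₁ p)) h → Good (cell (target h ∪ queried h) (val h))
    target-good h ok = good-transfer {plan} {target h ∪ queried h} {pred} {val h}
      (p⊆p∪q (queried h) ∘ plan⊆target h) pred∈ (val∈I h ok) same plan-good
      where
      same : ∀ {e f} → Open I e → e ∉ target h ∪ queried h → f ∈ plan → f ≢ e →
             SameSide e (pred f) (val h f)
      same {e} {f} o e∉ _ f≢e with f ∈? queried h
      ... | no f∉ rewrite val-default h f∉ = id , id
      ... | yes f∈ = proj₂ (sameRegion⇒sameSide {e} {val h f} {pred f} o
        (decidable-stable (Bool.T? (sameRegion (I e) (val h f) (pred f))) λ ¬t →
          e∉ (p⊆p∪q (queried h) (surprise⇒target h (L.lose (val-lookup h f∈) (f≢e , ¬t))))))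

    -- If both edges of a witness were off target, querying the target would leave their intervals
    -- alone, and `target-good` would contradict `witness-hit`.
    pair-exists : ∀ h → All (λ p → proj₂ p ∈I I (proj₁ p)) h → ¬ Good (state h) → ∃₂ (Pair h)
    pair-exists h ok ¬good = orient (witness-exists ordered ¬good)
      where
      ordered : ∀ e → lower (state h e) ℚ.≤ upper (state h e)
      ordered e with e ∈? queried h
      ... | yes _ = ℚ.≤-refl
      ... | no _ = lower≤upper (I e) (pred∈ e)
      orient : ∃₂ (IsWitness (state h)) → ∃₂ (Pair h)
      orient (e , f , wit) with e ∈? target h | f ∈? target h
      ... | yes e∈ | _ = e , f , e∈ , inj₁ wit
      ... | no _ | yes f∈ = f , e , f∈ , inj₂ wit
      ... | no e∉ | no f∉ = contradiction (target-good h ok) (witness-hit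
        (cell-refines {queried h} {target h ∪ queried h} {val h} {val h}
          (q⊆p∪q (target h) _) (val∈I h ok) (λ _ → refl)) wit
        (same e∉ (IsWitness.open-e wit)) (same f∉ (IsWitness.open-f wit)))
        where
        same : ∀ {x} → x ∉ target h → Open (state h) x → cell (target h ∪ queried h) (val h) x ≡ state h x
        same x∉ o = trans (cell-∉ _ (val h) ([ x∉ , open⇒∉ (queried h) (val h) o ] ∘ x∈p∪q⁻ (target h) _))
          (sym (cell-∉ (queried h) (val h) (open⇒∉ (queried h) (val h) o)))

strategy : ℕ → Strategy
strategy γ pub = Algorithm.next γ (Public.ends pub) (Public.I pub) (Public.pred pub)

-- Correctness and query count of a run

module Run (γ : ℕ) (2≤γ : 2 ≤ γ) {n m : ℕ} (inst : Instance n m) where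
  open Algorithm γ (ends inst) (I inst) (pred inst)
  open Analysis (pred∈I inst)
  open Graph (ends inst)
  open MST (ends inst)
  open Witness (ends inst)
  open Cells (I inst)
  open Transfer (ends inst) (I inst)

  Solves : Subset m → Set
  Solves Q = Good (cell Q (w inst))

  real-cell : ∀ Q → Real (cell Q (w inst)) (w inst)
  real-cell Q e with e ∈? Q
  ... | yes _ = refl
  ... | no _ = w∈I inst e

  feasible⇒solves : ∀ {Q} → Feasible inst Q → Solves Q
  feasible⇒solves {Q} (T , st , mst) = tree⇒good valid (real-cell Q) (spanningTree⇒tree st)
    λ w′ real T′ tr → proj₂ (mst w′
      (λ e e∈ → subst (w′ e ∈I_) (cell-∈ Q (w inst) e∈) (real e))
      (λ e e∉ → subst (w′ e ∈I_) (cell-∉ Q (w inst) e∉) (real e))) T′ (tree⇒spanningTree (connected inst) tr)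
    where
    valid : ∀ e → ValidInterval (cell Q (w inst) e)
    valid e with e ∈? Q
    ... | yes _ = _
    ... | no _ = I-valid inst e

  solves⇒feasible : ∀ {Q} → Solves Q → Feasible inst Q
  solves⇒feasible {Q} good with good⇒tree good (real-cell Q)
  ... | T , tr , min = T , st , λ w′ fixed free → st , λ T′ st′ →
        min w′ (real w′ fixed free) T′ (spanningTree⇒tree st′)
    where
    st : SpanningTree (ends inst) T
    st = tree⇒spanningTree (connected inst) tr
    real : ∀ w′ → (∀ e → e ∈ Q → w′ e ≡ w inst e) → (∀ e → e ∉ Q → w′ e ∈I I inst e) →
           Real (cell Q (w inst)) w′
    real w′ fixed free e with e ∈? Q
    ... | yes e∈ = fixed e e∈
    ... | no e∉ = free e e∉

  Truthful : History m → Set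
  Truthful = All (λ p → proj₂ p ≡ w inst (proj₁ p))

  truthful⇒∈I : ∀ {h} → Truthful h → All (λ p → proj₂ p ∈I I inst (proj₁ p)) h
  truthful⇒∈I = All.map λ { {x , _} refl → w∈I inst x }

  val≡w : ∀ h {e} → Truthful h → e ∈ queried h → val h e ≡ w inst e
  val≡w h tr e∈ = All.lookup tr (val-lookup h e∈)

  good⇒solves : ∀ h → Truthful h → Good (state h) → Solves (queried h)
  good⇒solves h tr = good-transfer {queried h} {queried h} {val h} {w inst} id
    (val∈I h (truthful⇒∈I tr)) (w∈I inst)
    λ {e} {f} _ _ f∈ _ → subst (SameSide e (val h f)) (val≡w h tr f∈) (id , id)

  witness-∉ : ∀ h {e f} → IsWitness (state h) e f → e ∉ queried h × f ∉ queried h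
  witness-∉ h wit = open⇒∉ (queried h) (val h) (IsWitness.open-e wit)
                  , open⇒∉ (queried h) (val h) (IsWitness.open-f wit)

  pair-∉ : ∀ h {a b} → Pair h a b → a ∉ queried h × b ∉ queried h
  pair-∉ h (_ , inj₁ wit) = witness-∉ h wit
  pair-∉ h (_ , inj₂ wit) = proj₂ (witness-∉ h wit) , proj₁ (witness-∉ h wit)

  -- The queries made so far are added to `O`, so that the union both solves the instance and
  -- refines the current state.
  witness-met : ∀ h {e f} O → Truthful h → IsWitness (state h) e f → Solves O → e ∈ O ⊎ f ∈ O
  witness-met h {e} {f} O tr wit sol with e ∈? O | f ∈? O
  ... | yes e∈ | _ = inj₁ e∈
  ... | no _ | yes f∈ = inj₂ f∈
  ... | no e∉ | no f∉ = contradiction pooled (witness-hit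
          (cell-refines {queried h} {Q} {val h} {w inst} (q⊆p∪q O _) (w∈I inst) (val≡w h tr)) wit
          (same e∉ (proj₁ (witness-∉ h wit))) (same f∉ (proj₂ (witness-∉ h wit))))
    where
    Q : Subset m
    Q = O ∪ queried h
    pooled : Good (cell Q (w inst))
    pooled = good-transfer {O} {Q} {w inst} {w inst} (p⊆p∪q (queried h)) (w∈I inst) (w∈I inst)
      (λ _ _ _ _ → id , id) sol
    same : ∀ {x} → x ∉ O → x ∉ queried h → cell Q (w inst) x ≡ state h x
    same x∉O x∉ = trans (cell-∉ Q (w inst) ([ x∉O , x∉ ] ∘ x∈p∪q⁻ O _))
                        (sym (cell-∉ (queried h) (val h) x∉))

  pair-hit : ∀ h {a b} O → Truthful h → Pair h a b → Solves O → a ∈ O ⊎ b ∈ O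
  pair-hit h O tr (_ , inj₁ wit) sol = witness-met h O tr wit sol
  pair-hit h O tr (_ , inj₂ wit) sol = Sum.swap (witness-met h O tr wit sol)

  query : History m → Fin m → History m
  query h x = (x , w inst x) ∷ h

  -- g counts the completed groups and p the queries of the current one.
  record Invariant (h : History m) (g p : ℕ) : Set where
    field
      truthful  : Truthful h
      phase≤γ   : p ≤ γ
      counted   : length h ≡ g * suc γ + p
      distinct  : length h ≤ ∣ queried h ∣
      -- The closing query of a group may be off target, so a complete group counts only `γ`.
      on-target : g * γ + p ≤ ∣ queried h ∩ target h ∣
      hits      : ∀ O → Solves O → g ≤ ∣ O ∩ queried h ∣
      -- Before a group closes, its last query and the companion together hold one more edge of each
      -- solution.
      half-hit  : p ≡ γ → ∃ λ b → companion h ≡ just b ×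
                  (∀ O → Solves O → suc g ≤ ∣ O ∩ (queried h ∪ ⁅ b ⁆) ∣)
      robust    : ∀ O → Solves O → length h ≤ suc γ * ∣ O ∣

  Inv : History m → Set
  Inv h = Invariant h (groups h) (phase h)

  start : Inv []
  start = record
    { truthful = [] ; phase≤γ = z≤n ; counted = refl ; distinct = z≤n ; on-target = z≤n
    ; hits = λ _ _ → z≤n ; robust = λ _ _ → z≤n
    ; half-hit = λ 0≡γ → contradiction (subst (2 ≤_) (sym 0≡γ) 2≤γ) λ () }

  module _ (h : History m) (inv : Inv h) {a b} (pr : Pair h a b) where
    open Invariant inv

    a∉ : a ∉ queried h
    a∉ = proj₁ (pair-∉ h pr)

    b∉ : b ∉ queried h
    b∉ = proj₂ (pair-∉ h pr)

    grow : ∀ x → queried h S.⊆ queried (query h x)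
    grow x = q⊆p∪q ⁅ x ⁆ (queried h)

    new : ∀ x → x ∈ queried (query h x)
    new x = p⊆p∪q (queried h) (x∈⁅x⁆ x)

    still-distinct : ∀ {x} → x ∉ queried h → suc (length h) ≤ ∣ queried (query h x) ∣
    still-distinct {x} x∉ = ℕ.≤-<-trans distinct (p⊂q⇒∣p∣<∣q∣ (grow x , x , new x , x∉))

    -- One edge of the pair is unqueried and in `O`, so `O` has more than `groups h` edges; the
    -- excess pays for the at most `γ + 1` queries of the current group.
    still-robust : ∀ O → Solves O → suc (length h) ≤ suc γ * ∣ O ∣
    still-robust O sol = begin
      suc (length h)                          ≡⟨ cong suc counted ⟩
      suc (groups h * suc γ + phase h)        ≡⟨ ℕ.+-suc _ _ ⟨
      groups h * suc γ + suc (phase h)        ≤⟨ ℕ.+-monoʳ-≤ (groups h * suc γ) (s≤s phase≤γ) ⟩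
      groups h * suc γ + suc γ                ≡⟨ ℕ.+-comm _ (suc γ) ⟩
      suc (groups h) * suc γ                  ≤⟨ ℕ.*-monoˡ-≤ (suc γ) (ℕ.≤-<-trans (hits O sol) missing) ⟩
      ∣ O ∣ * suc γ                           ≡⟨ ℕ.*-comm ∣ O ∣ (suc γ) ⟩
      suc γ * ∣ O ∣                           ∎
      where
      open ℕ.≤-Reasoning
      outsider : ∃ λ x → x ∈ O × x ∉ queried h
      outsider with pair-hit h O truthful pr sol
      ... | inj₁ a∈ = a , a∈ , a∉
      ... | inj₂ b∈ = b , b∈ , b∉
      missing : ∣ O ∩ queried h ∣ ℕ.< ∣ O ∣
      missing with outsider
      ... | x , x∈O , x∉ = p⊂q⇒∣p∣<∣q∣ (p∩q⊆p O _ , x , x∈O , x∉ ∘ proj₂ ∘ x∈p∩q⁻ O _)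

    lead-on-target : ∣ queried h ∩ target h ∣ ℕ.< ∣ queried (query h a) ∩ target (query h a) ∣
    lead-on-target = ∣∩∣-grows (grow a) (target-mono _ h) (new a) (target-mono _ h (proj₁ pr))
      (a∉ ∘ proj₁ ∘ x∈p∩q⁻ (queried h) _)

    lead-half-hit : ∀ O → Solves O → ∣ O ∩ queried h ∣ ℕ.< ∣ O ∩ (queried (query h a) ∪ ⁅ b ⁆) ∣
    lead-half-hit O sol with pair-hit h O truthful pr sol
    ... | inj₁ a∈ = ∣∩∣-grows {p = O} id (p⊆p∪q ⁅ b ⁆ ∘ grow a) a∈
            (p⊆p∪q ⁅ b ⁆ (new a)) (a∉ ∘ proj₂ ∘ x∈p∩q⁻ O _)
    ... | inj₂ b∈ = ∣∩∣-grows {p = O} id (p⊆p∪q ⁅ b ⁆ ∘ grow a) b∈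
            (q⊆p∪q _ _ (x∈⁅x⁆ b)) (b∉ ∘ proj₂ ∘ x∈p∩q⁻ O _)

    lead-step : phase h ≢ γ → companion (query h a) ≡ just b → Inv (query h a)
    lead-step p≢γ comp with phase h ℕ.≟ γ
    ... | yes p = contradiction p p≢γ
    ... | no _ = record
      { truthful = refl ∷ truthful
      ; phase≤γ = ℕ.≤∧≢⇒< phase≤γ p≢γ
      ; counted = trans (cong suc counted) (sym (ℕ.+-suc (groups h * suc γ) (phase h)))
      ; distinct = still-distinct a∉
      ; on-target = subst (_≤ ∣ queried (query h a) ∩ target (query h a) ∣)
          (sym (ℕ.+-suc (groups h * γ) (phase h))) (ℕ.≤-<-trans on-target lead-on-target)
      ; hits = λ O sol → ℕ.≤-trans (hits O sol) (p⊆q⇒∣p∣≤∣q∣ (∩-mono-⊆ {p = O} id (grow a)))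
      ; half-hit = λ _ → b , comp , λ O sol → ℕ.≤-<-trans (hits O sol) (lead-half-hit O sol)
      ; robust = still-robust }

    -- The closing query `x` is the companion `c`, or a substitute if `c` is already queried. Either
    -- way `c` is queried afterwards, which turns `half-hit` into a further hit.
    follow-step : ∀ {c x} → phase h ≡ γ →
      (∀ O → Solves O → suc (groups h) ≤ ∣ O ∩ (queried h ∪ ⁅ c ⁆) ∣) →
      x ∉ queried h → c ∈ queried (query h x) → Inv (query h x)
    follow-step {c} {x} p≡γ half x∉ c∈ with phase h ℕ.≟ γ
    ... | no p≢γ = contradiction p≡γ p≢γ
    ... | yes _ = record
      { truthful = refl ∷ truthful
      ; phase≤γ = z≤n
      ; counted = count
      ; distinct = still-distinct x∉
      ; on-target = ℕ.≤-trans (ℕ.≤-reflexive regroup) (ℕ.≤-trans on-target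
          (p⊆q⇒∣p∣≤∣q∣ (∩-mono-⊆ (grow x) (target-mono _ h))))
      ; hits = λ O sol → ℕ.≤-trans (half O sol) (p⊆q⇒∣p∣≤∣q∣ (∩-mono-⊆ {p = O} id covers))
      ; half-hit = λ 0≡γ → contradiction (subst (2 ≤_) (sym 0≡γ) 2≤γ) λ ()
      ; robust = still-robust }
      where
      count : suc (length h) ≡ suc (groups h) * suc γ + 0
      count = trans (cong suc (trans counted (cong (groups h * suc γ +_) p≡γ)))
        (solve 2 (λ g k → con 1 :+ (g :* (con 1 :+ k) :+ k) := (con 1 :+ g) :* (con 1 :+ k) :+ con 0)
          refl (groups h) γ)
        where open +-*-Solver
      regroup : suc (groups h) * γ + 0 ≡ groups h * γ + phase h
      regroup = trans (trans (ℕ.+-identityʳ _) (ℕ.+-comm γ _)) (cong (groups h * γ +_) (sym p≡γ))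
      covers : queried h ∪ ⁅ c ⁆ S.⊆ queried (query h x)
      covers y∈ with x∈p∪q⁻ (queried h) ⁅ c ⁆ y∈
      ... | inj₁ p = grow x p
      ... | inj₂ q rewrite x∈⁅y⁆⇒x≡y c q = c∈

  Progress : History m → Maybe (Fin m) → Set
  Progress h nothing = Good (state h)
  Progress h (just x) = Inv (query h x)

  progress : ∀ h → Inv h → Progress h (next h)
  progress h inv = go (good? (state h)) (pair? h) refl (phase h ℕ.≟ γ)
    where
    -- The equation ties the pair in use to the one that `companion` recovers after the query.
    go : ∀ d₁ d₂ → second (pair? h) ≡ second d₂ → ∀ d₃ → Progress h (choose h d₁ d₂ d₃)
    go (yes good) _ _ _ = good
    go (no ¬good) (no none) _ _ =
      contradiction (pair-exists h (truthful⇒∈I (Invariant.truthful inv)) ¬good) none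
    go (no _) (yes (a , b , pr)) eq (no p≢γ) = lead-step h inv pr p≢γ eq
    go (no _) (yes (a , b , pr)) _ (yes p≡γ) with Invariant.half-hit inv p≡γ
    ... | c , comp , half = follow (companion h) comp
      where
      follow : ∀ c? → c? ≡ just c → Inv (query h (unlessQueried h a c?))
      follow .(just c) refl with c ∈? queried h
      ... | yes c∈ = follow-step h inv pr p≡γ half (a∉ h inv pr) (grow h inv pr a c∈)
      ... | no c∉ = follow-step h inv pr p≡γ half c∉ (new h inv pr c)

  -- Queries are distinct, so there are at most `m` of them. Fuel and history length together exceed
  -- `m`, hence the fuel does not run out.
  terminates : ∀ k h → Inv h → m ℕ.< k + length h →
               ∃ λ h′ → run (strategy γ) inst k h ≡ just h′ × Inv h′ × Good (state h′)
  terminates zero h inv m<k =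
    contradiction (ℕ.<-≤-trans m<k (ℕ.≤-trans (Invariant.distinct inv) (∣p∣≤n (queried h)))) (ℕ.<-irrefl refl)
  terminates (suc k) h inv m<k with next h | progress h inv
  ... | nothing | good = h , refl , inv , good
  ... | just x | inv′ = terminates k (query h x) inv′ (subst (m ℕ.<_) (sym (ℕ.+-suc k (length h))) m<k)

  -- The size of the target and the hop distance

  Changed : Fin m → Set
  Changed e = ∃ λ x → 1 ≤ hop inst x e

  changed? : Decidable Changed
  changed? e = any? λ x → 1 ℕ.≤? hop inst x e

  changed : Subset m
  changed = subset changed?

  -- Exchanging the two sums groups the hop distance by the edge whose interval defines the regions;
  -- each changed edge contributes at least one.
  ∣changed∣≤hop : ∣ changed ∣ ≤ hopDistance inst
  ∣changed∣≤hop = ℕ.≤-trans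
    (∣p∣≤finSum (λ e → finSum (λ x → hop inst x e)) changed λ {e} e∈ →
      let x , 1≤ = ∈-subset⁻ changed? e∈ in ℕ.≤-trans 1≤ (f≤finSum (λ x → hop inst x e) x))
    (ℕ.≤-reflexive (sym (finSum-comm (hop inst))))

  hop-positive : ∀ {x e} → x ≢ e → ¬ Bool.T (sameRegion (I inst e) (w inst x) (pred inst x)) → 1 ≤ hop inst x e
  hop-positive {x} {e} x≢e ¬t with x ≟ e
  ... | yes x≡e = contradiction x≡e x≢e
  ... | no _ with sameRegion (I inst e) (w inst x) (pred inst x)
  ...   | true = contradiction _ ¬t
  ...   | false = s≤s z≤n

  target⊆ : ∀ h → Truthful h → target h S.⊆ plan ∪ changed
  target⊆ h tr e∈ with target⁻ h e∈
  ... | inj₁ p = p⊆p∪q changed p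
  ... | inj₂ q = q⊆p∪q plan changed (∈-subset⁺ changed? (go tr q))
    where
    go : ∀ {h e} → Truthful h → Surprise h e → Changed e
    go {(x , _) ∷ _} (refl ∷ _) (here (x≢e , ¬t)) = x , hop-positive x≢e ¬t
    go (_ ∷ tr) (there s) = go tr s

  -- Transfer from `w` back to the predictions: a solution enlarged by `changed` is good for them,
  -- and the plan is smallest there.
  ∣plan∣≤ : ∀ O → Solves O → ∣ plan ∣ ≤ ∣ O ∣ + hopDistance inst
  ∣plan∣≤ O sol = ℕ.≤-trans (plan-minimal (O ∪ changed) predicted)
    (ℕ.≤-trans (∣p∪q∣≤∣p∣+∣q∣ O changed) (ℕ.+-monoʳ-≤ ∣ O ∣ ∣changed∣≤hop))
    where
    predicted : Good (cell (O ∪ changed) (pred inst))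
    predicted = good-transfer {O} {O ∪ changed} {w inst} {pred inst} (p⊆p∪q changed) (w∈I inst) (pred∈I inst)
      (λ {e} {f} o e∉ f∈ f≢e → proj₁ (sameRegion⇒sameSide {e} {w inst f} {pred inst f} o
        (decidable-stable (Bool.T? (sameRegion (I inst e) (w inst f) (pred inst f))) λ ¬t →
          e∉ (q⊆p∪q O changed (∈-subset⁺ changed? (f , hop-positive f≢e ¬t)))))) sol

  -- The hop distance is paid twice, once for the plan and once for the surprises.
  ∣target∣≤ : ∀ h O → Truthful h → Solves O → ∣ target h ∣ ≤ ∣ O ∣ + 2 * hopDistance inst
  ∣target∣≤ h O tr sol = begin
    ∣ target h ∣                                       ≤⟨ p⊆q⇒∣p∣≤∣q∣ (target⊆ h tr) ⟩
    ∣ plan ∪ changed ∣                                 ≤⟨ ∣p∪q∣≤∣p∣+∣q∣ plan changed ⟩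
    ∣ plan ∣ + ∣ changed ∣                             ≤⟨ ℕ.+-mono-≤ (∣plan∣≤ O sol) ∣changed∣≤hop ⟩
    ∣ O ∣ + hopDistance inst + hopDistance inst        ≡⟨ ℕ.+-assoc ∣ O ∣ _ _ ⟩
    ∣ O ∣ + (hopDistance inst + hopDistance inst)      ≡⟨ cong (λ k → ∣ O ∣ + (hopDistance inst + k)) (ℕ.+-identityʳ _) ⟨
    ∣ O ∣ + 2 * hopDistance inst                       ∎
    where open ℕ.≤-Reasoning

  ∣queried∣≤length : ∀ (h : History m) → ∣ queried h ∣ ≤ length h
  ∣queried∣≤length [] = ℕ.≤-reflexive (∣⊥∣≡0 m)
  ∣queried∣≤length ((x , _) ∷ h) = ℕ.≤-trans (∣p∪q∣≤∣p∣+∣q∣ ⁅ x ⁆ (queried h))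
    (ℕ.+-mono-≤ (ℕ.≤-reflexive (∣⁅x⁆∣≡1 x)) (∣queried∣≤length h))

  consistent-bound : ∀ h O → Inv h → Solves O →
    γ * ∣ queried h ∣ ≤ (γ + 1) * ∣ O ∣ + 5 * γ * hopDistance inst
  consistent-bound h O inv sol = begin
    γ * ∣ queried h ∣                        ≤⟨ ℕ.*-monoʳ-≤ γ (∣queried∣≤length h) ⟩
    γ * length h                             ≡⟨ cong (γ *_) counted ⟩
    -- The added `p` makes the sum a multiple of `γ + 1`, which charges each group to its `γ` target
    -- queries.
    γ * (g * suc γ + p)                      ≤⟨ ℕ.m≤m+n _ p ⟩
    γ * (g * suc γ + p) + p                  ≡⟨ solve 3 (λ k g p → k :* (g :* (con 1 :+ k) :+ p) :+ p :=
                                                  (k :+ con 1) :* (g :* k :+ p)) refl γ g p ⟩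
    (γ + 1) * (g * γ + p)                    ≤⟨ ℕ.*-monoʳ-≤ (γ + 1) on-target ⟩
    (γ + 1) * ∣ queried h ∩ target h ∣       ≤⟨ ℕ.*-monoʳ-≤ (γ + 1) (∣p∩q∣≤∣q∣ (queried h) (target h)) ⟩
    (γ + 1) * ∣ target h ∣                   ≤⟨ ℕ.*-monoʳ-≤ (γ + 1) (∣target∣≤ h O truthful sol) ⟩
    (γ + 1) * (∣ O ∣ + 2 * k)                ≡⟨ solve 3 (λ c o k → (c :+ con 1) :* (o :+ con 2 :* k) :=
                                                  (c :+ con 1) :* o :+ (con 2 :* c :+ con 2) :* k) refl γ ∣ O ∣ k ⟩
    (γ + 1) * ∣ O ∣ + (2 * γ + 2) * k        ≤⟨ ℕ.+-monoʳ-≤ ((γ + 1) * ∣ O ∣) (ℕ.*-monoˡ-≤ k enough) ⟩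
    (γ + 1) * ∣ O ∣ + 5 * γ * k              ∎
    where
    open Invariant inv
    open ℕ.≤-Reasoning
    open +-*-Solver using (solve; _:+_; _:*_; _:=_; con)
    g p k : ℕ
    g = groups h
    p = phase h
    k = hopDistance inst
    -- Since `2 ≤ γ`, already `3 * γ` suffices; the theorem allows `5 * γ`.
    enough : 2 * γ + 2 ≤ 5 * γ
    enough = begin
      2 * γ + 2              ≤⟨ ℕ.+-monoʳ-≤ (2 * γ) 2≤γ ⟩
      2 * γ + γ              ≤⟨ ℕ.m≤m+n _ (2 * γ) ⟩
      2 * γ + γ + 2 * γ      ≡⟨ solve 1 (λ c → con 2 :* c :+ c :+ con 2 :* c := con 5 :* c) refl γ ⟩
      5 * γ                  ∎

  robust-bound : ∀ h O → Inv h → Solves O → ∣ queried h ∣ ≤ (γ + 1) * ∣ O ∣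
  robust-bound h O inv sol = ℕ.≤-trans (∣queried∣≤length h)
    (subst (λ c → length h ≤ c * ∣ O ∣) (ℕ.+-comm 1 γ) (Invariant.robust inv O sol))

theorem5p2 : (γ : ℕ) → 2 ≤ γ →
    Σ Strategy λ A → ∀ {n m} (inst : Instance n m) →
    ∃ λ h → (∃ λ k → run A inst k [] ≡ just h)
    × Feasible inst (queried h)
    × (∀ O → IsOPT inst O →
    (γ * ∣ queried h ∣ ≤ (γ + 1) * ∣ O ∣ + 5 * γ * hopDistance inst)
    × (∣ queried h ∣ ≤ (γ + 1) * ∣ O ∣))
theorem5p2 γ 2≤γ = strategy γ , λ {n} {m} inst →
  let open Run γ 2≤γ inst
      h , ran , inv , good = terminates (suc m) [] start (s≤s (ℕ.m≤m+n m 0))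
  in h , (suc m , ran) , solves⇒feasible (good⇒solves h (Invariant.truthful inv) good) ,
     λ O (feasible , _) → let sol = feasible⇒solves feasible in
       consistent-bound h O inv sol , robust-bound h O inv sol
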